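{- Let $N\ge 3$ and let $W_{N+1}$ be the wheel graph with rim vertices $v_1,\ldots,v_N$ and central vertex $c$. Let $1\le r\le N$, let $R=\{v_{a_1},v_{a_2},\ldots,v_{a_r}\}$ with $1\le a_1<a_2<\cdots<a_r\le N$, and define $d_i=a_{i+1}-a_i$ for $1\le i\le r-1$ and $d_r=a_1+N-a_r$. Then the number $\mathcal F_{W_{N+1}}(R)$ of rooted spanning forests of $W_{N+1}$ with root set $R$ is $$\mathcal F_{W_{N+1}}(R)=\left(\prod_{i=1}^{r}F_{2d_i}\right)\left(\sum_{i=1}^{r}\frac{L_{2d_i}-2}{F_{2d_i}}\right)=\sum_{i=1}^{r}\left(L_{2d_i}-2\right)\prod_{\substack{1\le j\le r\\ j\ne i}}F_{2d_j}.$$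
   Context: The wheel graph $W_{N+1}$ ($N\ge3$) has vertex set $\{c,v_1,\ldots,v_N\}$ and edges $\{v_i,v_{i+1}\}$ (indices modulo $N$) and $\{c,v_i\}$ for $1\le i\le N$. For a finite connected graph $G$ and $\varnothing\ne R\subseteq V(G)$, a rooted spanning forest of $G$ with root set $R$ is a spanning forest (an acyclic subgraph containing all vertices of $G$) in which each connected component contains exactly one vertex of $R$; $\mathcal F_G(R)$ denotes the number of such forests. Fibonacci numbers: $F_0=0$, $F_1=1$, $F_{n+2}=F_{n+1}+F_n$. Lucas numbers: $L_0=2$, $L_1=1$, $L_{n+2}=L_{n+1}+L_n$. -}

module Defs where

open import Data.Fin.Base as Fin using (Fin; zero; suc; toℕ; fromℕ<; splitAt)
open import Data.Fin.Properties using (_≟_; all?; any?; injective⇒≤; suc-injective; toℕ<n; toℕ-fromℕ<; join-splitAt)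
open import Data.Fin.Subset using (Subset; inside; outside; _∈_; ⁅_⁆; ⋃)
open import Data.Fin.Subset.Properties using (_∈?_)
open import Data.Integer.Properties as ℤ using ()
open import Data.List.Base using (List; []; _∷_; _++_; map; filter; length; allFin; tabulate)
open import Data.List.Membership.Propositional using () renaming (_∈_ to _∈ₗ_)
open import Data.List.Membership.Propositional.Properties using (∈-allFin)
open import Data.List.Relation.Unary.Any using (here; there)
open import Data.Nat.Base using (ℕ; zero; suc; _+_; _*_; _∸_; _≤_; _<_; NonZero; s≤s; z<s; >-nonZero)
open import Data.Nat.DivMod using (_mod_; _%_; m<n⇒m%n≡m; n%n≡0)
open import Data.Nat.Properties as ℕ using (_<?_; anyUpTo?)
open import Data.Product.Base using (∃; ∃-syntax; _×_; _,_; proj₁; proj₂; swap)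
open import Data.Product.Properties using (≡-dec; ,-injective)
open import Data.Product using (∃!)
open import Data.Rational.Properties as ℚ using ()
open import Data.Sum.Base using (_⊎_; inj₁; inj₂; [_,_]′)
open import Data.Vec.Base using (Vec; []; _∷_; lookup)
open import Data.Vec.Functional using (removeAt)
open import Data.Vec.Relation.Unary.AllPairs using (allPairs?)
open import Data.Vec.Relation.Unary.Unique.Propositional using (Unique)
open import Data.Vec.Relation.Unary.Unique.Propositional.Properties using (lookup-injective)
open import Level using (0ℓ)
open import Relation.Binary.Construct.Closure.ReflexiveTransitive using (Star; ε; _◅_; _◅◅_)
open import Relation.Binary.Core using (Rel; _Preserves_⟶_)
open import Relation.Binary.Definitions using () renaming (Decidable to Decidable₂)
open import Relation.Binary.PropositionalEquality using (_≡_; _≢_; refl; sym; trans; cong; subst)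
open import Relation.Nullary using (Dec; yes; no; ¬_; ¬?; contradiction; map′; _×-dec_; _⊎-dec_; _→-dec_)
open import Relation.Unary using (Pred; Decidable)

open import Algebra.Properties.CommutativeMonoid.Sum ℚ.+-0-commutativeMonoid public using () renaming (sum to ∑ℚ)
open import Algebra.Properties.CommutativeMonoid.Sum ℤ.+-0-commutativeMonoid public using () renaming (sum to ∑ℤ)
open import Algebra.Properties.CommutativeMonoid.Sum ℕ.*-1-commutativeMonoid public using () renaming (sum to ∏)

private
  variable
    k m n : ℕ

∏-except : Fin n → (Fin n → ℕ) → ℕ
∏-except {suc _} i f = ∏ (removeAt f i)

next : Fin n → Fin n
next {suc n} i = suc (toℕ i) mod suc n

fib : ℕ → ℕ
fib 0             = 0
fib 1             = 1
fib (suc (suc n)) = fib (suc n) + fib n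

lucas : ℕ → ℕ
lucas 0             = 2
lucas 1             = 1
lucas (suc (suc n)) = lucas (suc n) + lucas n

Joins : (Fin m → Fin n × Fin n) → Fin m → Rel (Fin n) 0ℓ
Joins ends e u v = ends e ≡ (u , v) ⊎ ends e ≡ (v , u)

-- The two endpoints of an edge are listed in an arbitrary order.
record Graph : Set where
  field
    order    : ℕ
    size     : ℕ
    ends     : Fin size → Fin order × Fin order
    loopless : ∀ {e u} → ¬ Joins ends e u u
    simple   : ∀ {e f u v} → Joins ends e u v → Joins ends f u v → e ≡ f

  Vertex : Set
  Vertex = Fin order

-- A subgraph containing all vertices is determined by its set of edges.
module _ (G : Graph) (S : Subset (Graph.size G)) where
  open Graph G

  Adjacent : Rel Vertex 0ℓ
  Adjacent u v = ∃[ e ] e ∈ S × Joins ends e u v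

  Connected : Rel Vertex 0ℓ
  Connected = Star Adjacent

  IsCycle : Vec Vertex k → Set
  IsCycle vs = Unique vs × ∀ i → Adjacent (lookup vs i) (lookup vs (next i))

  Acyclic : Set
  Acyclic = ¬ (∃[ k ] ∃[ vs ] IsCycle {3 + k} vs)

  -- The components are the classes of Connected, each given by a vertex v in it.
  IsRootedForest : Subset order → Set
  IsRootedForest R = Acyclic × ∀ v → ∃! _≡_ λ r → r ∈ R × Connected v r

module _ {_~_ : Rel (Fin n) 0ℓ} (_~?_ : Decidable₂ _~_) where
  private
    -- Walks all of whose interior vertices belong to the given list.
    Via : List (Fin n) → Rel (Fin n) 0ℓ
    Via []       i j = i ≡ j ⊎ i ~ j
    Via (x ∷ xs) i j = Via xs i j ⊎ Via xs i x × Via xs x j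

    via? : ∀ xs → Decidable₂ (Via xs)
    via? []       i j = i ≟ j ⊎-dec i ~? j
    via? (x ∷ xs) i j = via? xs i j ⊎-dec via? xs i x ×-dec via? xs x j

    sound : ∀ xs {i j} → Via xs i j → Star _~_ i j
    sound []       (inj₁ refl)    = ε
    sound []       (inj₂ p)       = p ◅ ε
    sound (x ∷ xs) (inj₁ p)       = sound xs p
    sound (x ∷ xs) (inj₂ (p , q)) = sound xs p ◅◅ sound xs q

    base : ∀ xs {i j} → i ≡ j ⊎ i ~ j → Via xs i j
    base []       p = p
    base (x ∷ xs) p = inj₁ (base xs p)

    join : ∀ {xs i x j} → x ∈ₗ xs → Via xs i x → Via xs x j → Via xs i j
    join (here refl) p q = inj₂ (into p , from q)
      where
      into : ∀ {xs i x} → Via (x ∷ xs) i x → Via xs i x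
      into (inj₁ p)       = p
      into (inj₂ (p , _)) = p
      from : ∀ {xs x j} → Via (x ∷ xs) x j → Via xs x j
      from (inj₁ q)       = q
      from (inj₂ (_ , q)) = q
    join (there x∈) (inj₁ p)       (inj₁ q)       = inj₁ (join x∈ p q)
    join (there x∈) (inj₁ p)       (inj₂ (q , s)) = inj₂ (join x∈ p q , s)
    join (there x∈) (inj₂ (p , q)) (inj₁ s)       = inj₂ (p , join x∈ q s)
    join (there x∈) (inj₂ (p , _)) (inj₂ (_ , s)) = inj₂ (p , s)

    complete : ∀ {i j} → Star _~_ i j → Via (allFin n) i j
    complete ε        = base (allFin n) (inj₁ refl)
    complete (p ◅ ps) = join (∈-allFin _) (base (allFin n) (inj₂ p)) (complete ps)

  star? : Decidable₂ (Star _~_)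
  star? i j = map′ (sound (allFin n)) complete (via? (allFin n) i j)

anyVec? : {P : Pred (Vec (Fin n) k) 0ℓ} → Decidable P → Dec (∃ P)
anyVec? {k = zero}  P? = map′ (λ p → [] , p) (λ { ([] , p) → p }) (P? [])
anyVec? {k = suc k} P? = map′ (λ { (x , xs , p) → x ∷ xs , p }) (λ { (x ∷ xs , p) → x , xs , p })
  (any? λ x → anyVec? λ xs → P? (x ∷ xs))

module _ (G : Graph) (S : Subset (Graph.size G)) where
  open Graph G

  adjacent? : Decidable₂ (Adjacent G S)
  adjacent? u v = any? λ e → e ∈? S ×-dec (≡-dec _≟_ _≟_ (ends e) (u , v) ⊎-dec ≡-dec _≟_ _≟_ (ends e) (v , u))

  connected? : Decidable₂ (Connected G S)
  connected? = star? adjacent?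

  isCycle? : Decidable (IsCycle G S {k})
  isCycle? vs = allPairs? (λ u v → ¬? (u ≟ v)) vs ×-dec
    all? λ i → adjacent? (lookup vs i) (lookup vs (next i))

  acyclic? : Dec (Acyclic G S)
  acyclic? = ¬? (map′ (λ { (k , _ , c) → k , c }) bound (anyUpTo? (λ k → anyVec? (isCycle? {3 + k})) (order ∸ 2)))
    where
    bound : ∃[ k ] ∃ (IsCycle G S {3 + k}) → ∃[ k ] k < order ∸ 2 × ∃ (IsCycle G S {3 + k})
    bound (k , vs , c) =
      k , ℕ.∸-monoˡ-≤ 2 (injective⇒≤ (lookup-injective (proj₁ c) _ _)) , vs , c

  isRootedForest? : Decidable (IsRootedForest G S)
  isRootedForest? R = acyclic? ×-dec all? λ v → any? λ r →
    root? v r ×-dec map′ (λ u {s} → u s) (λ u s → u) (all? λ s → root? v s →-dec r ≟ s)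
    where
    root? : ∀ v r → Dec (r ∈ R × Connected G S v r)
    root? v r = r ∈? R ×-dec connected? v r

subsets : ∀ m → List (Subset m)
subsets zero    = [] ∷ []
subsets (suc m) = map (outside ∷_) (subsets m) ++ map (inside ∷_) (subsets m)

𝓕 : (G : Graph) → Subset (Graph.order G) → ℕ
𝓕 G R = length (filter (λ S → isRootedForest? G S R) (subsets (Graph.size G)))

-- Rim edges {vᵢ , vᵢ₊₁} and spokes {c , vᵢ}: the centre c is zero, and the rim
-- vertex vᵢ (1 ≤ i ≤ N) is the element of Fin (suc N) with value i.
wheelEdge : Fin n ⊎ Fin n → Fin (suc n) × Fin (suc n)
wheelEdge (inj₁ i) = suc i , suc (next i)
wheelEdge (inj₂ i) = zero , suc i

wheelEnds : (N : ℕ) → Fin (N + N) → Fin (suc N) × Fin (suc N)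
wheelEnds N e = wheelEdge (splitAt N e)

toℕ-next : (i : Fin n) → toℕ (next i) ≡ suc (toℕ i) ⊎ (suc (toℕ i) ≡ n × toℕ (next i) ≡ 0)
toℕ-next {suc n} i with ℕ.m≤n⇒m<n∨m≡n (toℕ<n i)
... | inj₁ i+1<n = inj₁ (trans (toℕ-fromℕ< _) (m<n⇒m%n≡m i+1<n))
... | inj₂ i+1≡n = inj₂ (i+1≡n , trans (toℕ-fromℕ< _) (trans (cong (_% suc n) i+1≡n) (n%n≡0 (suc n))))

next≢ : 3 ≤ n → (i : Fin n) → i ≢ next i
next≢ 3≤n i eq with toℕ-next i
... | inj₁ p       = ℕ.1+n≢n (sym (trans (cong toℕ eq) p))
... | inj₂ (p , q) with subst (3 ≤_) (trans (sym p) (cong suc (trans (cong toℕ eq) q))) 3≤n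
...   | s≤s ()

next²≢ : 3 ≤ n → (i : Fin n) → i ≢ next (next i)
next²≢ 3≤n i eq with toℕ-next i | toℕ-next (next i)
... | inj₁ p       | inj₁ q       = ℕ.m≢1+n+m (toℕ i) {1} (trans (cong toℕ eq) (trans q (cong suc p)))
... | inj₁ p       | inj₂ (q , s)
  with subst (3 ≤_) (trans (sym q) (cong suc (trans p (cong suc (trans (cong toℕ eq) s))))) 3≤n
...   | s≤s (s≤s ())
next²≢ 3≤n i eq | inj₂ (p , q) | inj₁ s
  with subst (3 ≤_) (trans (sym p) (cong suc (trans (cong toℕ eq) (trans s (cong suc q))))) 3≤n
...   | s≤s (s≤s ())
next²≢ 3≤n i eq | inj₂ (p , q) | inj₂ (s , t)
  with subst (3 ≤_) (trans (sym s) (cong suc q)) 3≤n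
...   | s≤s ()

wheelEdge-loopless : 3 ≤ n → (x : Fin n ⊎ Fin n) → ∀ {u} → wheelEdge x ≢ (u , u)
wheelEdge-loopless 3≤n (inj₁ i) p with ,-injective p
... | q , s = next≢ 3≤n i (suc-injective (trans q (sym s)))
wheelEdge-loopless 3≤n (inj₂ i) p with ,-injective p
... | refl , ()

wheelEdge-injective : (x y : Fin n ⊎ Fin n) → wheelEdge x ≡ wheelEdge y → x ≡ y
wheelEdge-injective (inj₁ i) (inj₁ j) p = cong inj₁ (suc-injective (cong proj₁ p))
wheelEdge-injective (inj₁ i) (inj₂ j) p with () ← cong proj₁ p
wheelEdge-injective (inj₂ i) (inj₁ j) p with () ← cong proj₁ p
wheelEdge-injective (inj₂ i) (inj₂ j) p = cong inj₂ (suc-injective (cong proj₂ p))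

wheelEdge-oriented : 3 ≤ n → (x y : Fin n ⊎ Fin n) → wheelEdge x ≢ swap (wheelEdge y)
wheelEdge-oriented 3≤n (inj₁ i) (inj₁ j) p with ,-injective p
... | q , s = next²≢ 3≤n i (trans (suc-injective q) (cong next (sym (suc-injective s))))
wheelEdge-oriented 3≤n (inj₁ i) (inj₂ j) p with () ← cong proj₂ p
wheelEdge-oriented 3≤n (inj₂ i) (inj₁ j) p with () ← cong proj₁ p
wheelEdge-oriented 3≤n (inj₂ i) (inj₂ j) p with () ← cong proj₁ p

splitAt-injective : ∀ m {e f : Fin (m + n)} → splitAt m e ≡ splitAt m f → e ≡ f
splitAt-injective {n} m {e} {f} p =
  trans (sym (join-splitAt m n e)) (trans (cong (Fin.join m n) p) (join-splitAt m n f))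

wheel : (N : ℕ) → 3 ≤ N → Graph
wheel N 3≤N = record
  { order    = suc N
  ; size     = N + N
  ; ends     = wheelEnds N
  ; loopless = λ {e} → [ wheelEdge-loopless 3≤N (splitAt N e) , wheelEdge-loopless 3≤N (splitAt N e) ]′
  ; simple   = λ {e} {f} → simple e f
  }
  where
  simple : ∀ e f {u v} → Joins (wheelEnds N) e u v → Joins (wheelEnds N) f u v → e ≡ f
  simple e f (inj₁ p) (inj₁ q) = splitAt-injective N (wheelEdge-injective _ _ (trans p (sym q)))
  simple e f (inj₂ p) (inj₂ q) = splitAt-injective N (wheelEdge-injective _ _ (trans p (sym q)))
  simple e f (inj₁ p) (inj₂ q) = contradiction (trans p (cong swap (sym q))) (wheelEdge-oriented 3≤N _ (splitAt N f))
  simple e f (inj₂ p) (inj₁ q) = contradiction (trans p (cong swap (sym q))) (wheelEdge-oriented 3≤N _ (splitAt N f))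

-- Here and in gap, the value of a i is one less than the 1-based index aᵢ of
-- the root; this does not affect the gaps.
rimVertices : (Fin k → Fin n) → Subset (suc n)
rimVertices a = ⋃ (tabulate λ i → ⁅ suc (a i) ⁆)

gap : (Fin k → Fin n) → Fin k → ℕ
gap {suc k} {n} a i with suc (toℕ i) <? suc k
... | yes i+1<k = toℕ (a (fromℕ< i+1<k)) ∸ toℕ (a i)
... | no  _     = (toℕ (a zero) + n) ∸ toℕ (a i)

gap-positive : {a : Fin k → Fin n} → a Preserves Fin._<_ ⟶ Fin._<_ → ∀ i → 0 < gap a i
gap-positive {suc k} {a = a} a↑ i with suc (toℕ i) <? suc k
... | yes i+1<k = ℕ.m<n⇒0<n∸m (a↑ (ℕ.≤-reflexive (sym (toℕ-fromℕ< i+1<k))))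
... | no  _     = ℕ.m<n⇒0<n∸m (ℕ.≤-trans (toℕ<n (a i)) (ℕ.m≤n+m _ (toℕ (a zero))))

fib-positive : ∀ n → 0 < fib (suc n)
fib-positive zero    = z<s
fib-positive (suc n) = ℕ.≤-trans (fib-positive n) (ℕ.m≤m+n _ _)

fib-gap-nonZero : {a : Fin k → Fin n} → a Preserves Fin._<_ ⟶ Fin._<_ → ∀ i → NonZero (fib (2 * gap a i))
fib-gap-nonZero {a = a} a↑ i with gap a i | gap-positive a↑ i
... | suc d | _ = >-nonZero (fib-positive (d + 1 * suc d))

{-# OPTIONS --safe #-}

-- Cut the rim at its missing edges into paths. An edge set is a rooted forest
-- exactly when some rim edge is missing, every path has at most one spoke and at
-- most one root but not neither, and exactly one path has both. Reading the rim
-- vertices in cyclic order, this is checked by an automaton whose state records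
-- whether the current path has met a spoke and whether it has met a root. So the
-- forests are counted by the coefficient of ε in the trace of a product of 4 × 4
-- transfer matrices over the dual numbers, where ε marks a path with a spoke and
-- a root. A root is never read in a state that has met one, so the word of a root
-- followed by d - 1 non-roots matters only through its entries at the other two
-- states, which form a matrix
--     ( f + pε   g + qε )
--     (     fε       gε )      with f = F₂ₔ and p + g = L₂ₔ - 2.
-- Matrices of this shape are closed under products: f is multiplicative and
-- the trace coefficient p + g obeys the Leibniz rule, which gives the formula.

module Submission where

open import Defs
open import Algebra.Bundles using (CommutativeRing)
import Algebra.Properties.CommutativeMonoid.Sum as MonoidSum
import Algebra.Properties.Semiring.Sum as SemiringSum
open import Data.Bool.Base using (Bool; true; false; T; _∧_; _∨_; not; if_then_else_)
open import Data.Bool.Properties using (T?; T-∧; T-∨; T-≡)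
open import Data.Empty using (⊥; ⊥-elim)
open import Data.Fin.Base as Fin using (Fin; zero; suc; toℕ; fromℕ; fromℕ<; inject₁; splitAt; _↑ˡ_; _↑ʳ_)
open import Data.Fin.Induction using (<-weakInduction; <-weakInduction-startingFrom)
open import Data.Fin.Properties using (_≟_; any?; suc-injective; toℕ-injective; toℕ-inject₁; toℕ-fromℕ;
  toℕ<n; ≤fromℕ; ¬∀⟶∃¬; splitAt-↑ˡ; splitAt-↑ʳ; splitAt⁻¹-↑ˡ; splitAt⁻¹-↑ʳ)
open import Data.Fin.Relation.Unary.Top using (view; ‵fromℕ; ‵inject₁)
open import Data.Fin.Subset using (Subset; _∈_; _∉_; ⁅_⁆; ⋃; _∪_)
open import Data.Fin.Subset.Properties using (x∈⁅x⁆; x∈⁅y⁆⇒x≡y; x∈p∪q⁻; x∈p∪q⁺; ∉⊥)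
open import Data.Integer.Base as ℤ using (ℤ; +_)
import Data.Integer.Properties as ℤ
import Data.Integer.Solver as ℤ
open import Data.List.Base as List using (List; []; _∷_; _++_; replicate)
import Data.List.Properties as List
open import Data.Nat.Base as ℕ using (ℕ; zero; suc; pred; _+_; _*_; _∸_; _≤_; _<_; s≤s; z≤n; s≤s⁻¹; NonZero)
import Data.Nat.Properties as ℕ
open import Data.Nat.Solver using (module +-*-Solver)
open import Data.Product using (∃!)
open import Data.Product.Base using (∃; ∃-syntax; _×_; _,_; proj₁; proj₂)
open import Data.Rational.Base as ℚ using (_/_; toℚᵘ)
import Data.Rational.Properties as ℚ
open import Data.Rational.Unnormalised.Base as ℚᵘ using (mkℚᵘ; *≡*)
import Data.Rational.Unnormalised.Properties as ℚᵘ
open import Data.Sum.Base as Sum using (_⊎_; inj₁; inj₂; [_,_]′)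
open import Data.Unit.Base using (tt)
open import Data.Vec.Base as Vec using (Vec; []; _∷_; lookup; tabulate; toList)
open import Data.Vec.Properties using (lookup⇒[]=; []=⇒lookup; lookup-map; lookup∘tabulate; lookup-++ˡ; lookup-++ʳ)
open import Data.Vec.Relation.Unary.All as All using (All; []; _∷_)
import Data.Vec.Relation.Unary.All.Properties as All
open import Data.Vec.Relation.Unary.AllPairs using ([]; _∷_)
open import Data.Vec.Relation.Unary.Unique.Propositional using (Unique)
import Data.Vec.Relation.Unary.Unique.Propositional.Properties as Unique
open import Function.Base using (_∘_; id; case_of_)
open import Function.Bundles using (_⇔_; mk⇔; Equivalence)
open import Function.Properties.Equivalence using () renaming (trans to ⇔-trans)
open import Level using (0ℓ)
open import Relation.Binary.Construct.Closure.ReflexiveTransitive using (Star; ε; _◅_; _◅◅_; reverse; gmap)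
open import Relation.Binary.Core using (_Preserves_⟶_)
open import Relation.Binary.PropositionalEquality
open import Relation.Nullary using (Dec; yes; no; ¬_; contradiction; does; _×-dec_)
open import Relation.Nullary.Decidable using (does-⇔)
open import Relation.Unary using (Pred; Decidable)

open Equivalence using (to; from)
open +-*-Solver using (solve; _:+_; _:*_; _:=_; con)
open ℤ.+-*-Solver using () renaming (solve to ℤ-solve; _:+_ to _:ℤ+_; _:*_ to _:ℤ*_; _:=_ to _:ℤ=_; con to ℤ-con)
private
  module Prod = MonoidSum ℕ.*-1-commutativeMonoid
  module Sumℤ = SemiringSum (CommutativeRing.semiring ℤ.+-*-commutativeRing)
  module Sumℚ = SemiringSum (CommutativeRing.semiring ℚ.+-*-commutativeRing)

private
  variable
    k m n r : ℕ

-- Paths on the rim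

T-does : {A : Set} (a? : Dec A) → T (does a?) ⇔ A
T-does (yes a) = mk⇔ (λ _ → a) (λ _ → tt)
T-does (no ¬a) = mk⇔ (λ ()) ¬a

next-inject₁ : (i : Fin n) → next (inject₁ i) ≡ suc i
next-inject₁ i with toℕ-next (inject₁ i)
... | inj₁ p       = toℕ-injective (trans p (cong suc (toℕ-inject₁ i)))
... | inj₂ (p , _) = contradiction (ℕ.suc-injective (trans (cong suc (sym (toℕ-inject₁ i))) p)) (ℕ.<⇒≢ (toℕ<n i))

next-fromℕ : ∀ n → next (fromℕ n) ≡ zero
next-fromℕ n with toℕ-next (fromℕ n)
... | inj₁ p       = contradiction (trans p (cong suc (toℕ-fromℕ n))) (ℕ.<⇒≢ (toℕ<n (next (fromℕ n))))
... | inj₂ (_ , p) = toℕ-injective p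

next-injective : {i j : Fin n} → next i ≡ next j → i ≡ j
next-injective {suc n} {i} {j} p with view i | view j
... | ‵fromℕ     | ‵fromℕ     = refl
... | ‵inject₁ k | ‵inject₁ l = cong inject₁ (suc-injective (trans (sym (next-inject₁ k)) (trans p (next-inject₁ l))))
... | ‵fromℕ     | ‵inject₁ l with () ← trans (sym (next-fromℕ n)) (trans p (next-inject₁ l))
... | ‵inject₁ k | ‵fromℕ     with () ← trans (sym (next-fromℕ n)) (trans (sym p) (next-inject₁ k))

-- `next` is one cycle through all of `Fin n`, so the base case may sit anywhere: climb from `z` to
-- the top, wrap around to `zero`, then climb through everything.
next-induction : (P : Fin n → Set) {z : Fin n} → P z → (∀ i → P i → P (next i)) → ∀ i → P i
next-induction {suc n} P {z} Pz step =
  <-weakInduction P (subst P (next-fromℕ n) (step _ (<-weakInduction-startingFrom P Pz step′ (≤fromℕ z)))) step′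
  where
  step′ : ∀ i → P (inject₁ i) → P (suc i)
  step′ i p = subst P (next-inject₁ i) (step _ p)

next-surjective : (i : Fin n) → ∃[ j ] next j ≡ i
next-surjective i = next-induction (λ i → ∃[ j ] next j ≡ i) {next i} (i , refl) (λ i _ → i , refl) i

module Runs (ρ : Fin n → Bool) where

  infix 4 _⟶_ _⟶*_

  _⟶_ _⟶*_ : Fin n → Fin n → Set
  i ⟶ j = T (ρ i) × next i ≡ j
  _⟶*_ = Star _⟶_

  Cut : Fin n → Set
  Cut i = ¬ T (ρ i)

  length : ∀ {i j} → i ⟶* j → ℕ
  length ε       = 0
  length (_ ◅ p) = suc (length p)

  -- A vertex has at most one outgoing step and a cut has none, so following steps from `i` leads to
  -- a single cut in a fixed number of steps.
  runs-to-cuts-agree : ∀ {i d e} (p : i ⟶* d) (q : i ⟶* e) → Cut d → Cut e → d ≡ e × length p ≡ length q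
  runs-to-cuts-agree ε                ε                cd ce = refl , refl
  runs-to-cuts-agree ε                ((r , _) ◅ _)    cd ce = contradiction r cd
  runs-to-cuts-agree ((r , _) ◅ _)    ε                cd ce = contradiction r ce
  runs-to-cuts-agree ((_ , refl) ◅ p) ((_ , refl) ◅ q) cd ce with runs-to-cuts-agree p q cd ce
  ... | d≡e , l≡m = d≡e , cong suc l≡m

  last-step : ∀ {i j} → i ⟶* j → i ≡ j ⊎ ∃[ k ] i ⟶* k × k ⟶ j
  last-step ε       = inj₁ refl
  last-step (s ◅ p) with last-step p
  ... | inj₁ refl        = inj₂ (_ , ε , s)
  ... | inj₂ (k , q , t) = inj₂ (k , s ◅ q , t)

  -- Steps are unique backwards too, by `next-injective`: of two runs into the same vertex, the
  -- shorter is a final piece of the longer.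
  comparable : ∀ {i j e} → i ⟶* e → j ⟶* e → i ⟶* j ⊎ j ⟶* i
  comparable ε       q = inj₂ q
  comparable {i} (s@(r , refl) ◅ p) q with comparable p q
  ... | inj₁ p′ = inj₁ (s ◅ p′)
  ... | inj₂ q′ with last-step q′
  ...   | inj₁ refl                 = inj₁ (s ◅ ε)
  ...   | inj₂ (k , q″ , (_ , eq)) = inj₂ (subst (_ ⟶*_) (next-injective eq) q″)

  -- The bits x record, on reaching i, whether the rim path that ends in i has
  -- already met a vertex marked by σ; no such path meets two.
  record Seen (σ x : Fin n → Bool) : Set where
    field
      carried  : ∀ i → x (next i) ≡ ρ i ∧ (x i ∨ σ i)
      disjoint : ∀ i → T (x i) → ¬ T (σ i)

    carry : ∀ {i j} → i ⟶ j → T (x i ∨ σ i) → T (x j)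
    carry {i} (r , refl) t = subst T (sym (carried i)) (from T-∧ (r , t))

    complete : ∀ {i j} → i ⟶* j → T (x i ∨ σ i) → T (x j ∨ σ j)
    complete ε       t = t
    complete (s ◅ p) t = complete p (from T-∨ (inj₁ (carry s t)))

    from-mark : ∀ {i} → T (σ i) → T (x i ∨ σ i)
    from-mark s = from T-∨ (inj₂ s)

    -- If the run had a step, its end would be read with the bit already set, and `disjoint` forbids
    -- a mark there.
    path-trivial : ∀ {i j} → i ⟶* j → T (σ i) → T (σ j) → i ≡ j
    path-trivial p s t with last-step p
    ... | inj₁ i≡j         = i≡j
    ... | inj₂ (k , q , r) = contradiction t (disjoint _ (carry r (complete q (from-mark s))))

    module _ {z} (cut : Cut z) where
      after-cut : x (next z) ≡ false
      after-cut with ρ z | carried z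
      ... | true  | _ = contradiction tt cut
      ... | false | p = p

      -- Converse of `complete`. The induction starts just after the cut, where the bit is known to
      -- be off; on a rim without a cut all bits could be on without any mark.
      sound : ∀ i → T (x i ∨ σ i) → ∃[ j ] T (σ j) × j ⟶* i
      sound = next-induction _
        (λ t → _ , subst (λ b → T (b ∨ σ (next z))) after-cut t , ε)
        (λ i ih t → case to T-∨ t of λ
          { (inj₂ s) → _ , s , ε
          ; (inj₁ u) → let r , v = to T-∧ (subst T (carried i) u)
                           j , s , p = ih v
                       in j , s , p ◅◅ (r , refl) ◅ ε })

  -- The recurrence `carried` determines each bit from the preceding one, and `after-cut` supplies a
  -- common initial value.
  Seen-unique : ∀ {σ x y z} → Cut z → Seen σ x → Seen σ y → ∀ i → x i ≡ y i
  Seen-unique {σ} cut X Y = next-induction _ (trans (Seen.after-cut X cut) (sym (Seen.after-cut Y cut)))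
    (λ i p → trans (Seen.carried X i) (trans (cong (λ b → ρ i ∧ (b ∨ σ i)) p) (sym (Seen.carried Y i))))

  Ends : (σ : Fin n → Bool) → Fin n → Set
  Ends σ i = ∃[ j ] T (σ j) × j ⟶* i

  _⟶*?_ : ∀ i j → Dec (i ⟶* j)
  _⟶*?_ = star? (λ i j → T? (ρ i) ×-dec next i ≟ j)

  ends? : ∀ σ i → Dec (Ends σ i)
  ends? σ i = any? λ j → T? (σ j) ×-dec j ⟶*? i

  before? : ∀ σ i → Dec (∃[ k ] next k ≡ i × T (ρ k) × Ends σ k)
  before? σ i = any? λ k → next k ≟ i ×-dec T? (ρ k) ×-dec ends? σ k

  -- Decided by reachability instead of by the recurrence `carried`, which has no starting point on
  -- a cycle; `seen-carried` recovers the recurrence.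
  seen : (σ : Fin n → Bool) → Fin n → Bool
  seen σ i = does (before? σ i)

  seen-⇔ : ∀ σ i → T (seen σ i) ⇔ (∃[ k ] next k ≡ i × T (ρ k) × Ends σ k)
  seen-⇔ σ i = T-does (before? σ i)

  seen∨⇔Ends : ∀ σ i → T (seen σ i ∨ σ i) ⇔ Ends σ i
  seen∨⇔Ends σ i = mk⇔ forth back
    where
    forth : T (seen σ i ∨ σ i) → Ends σ i
    forth t with to T-∨ t
    ... | inj₂ s = i , s , ε
    ... | inj₁ u with to (seen-⇔ σ i) u
    ...   | k , eq , r , j , s , p = j , s , p ◅◅ (r , eq) ◅ ε
    back : Ends σ i → T (seen σ i ∨ σ i)
    back (j , s , p) with last-step p
    ... | inj₁ refl               = from T-∨ (inj₂ s)
    ... | inj₂ (k , q , r , refl) = from (T-∨ {seen σ i}) (inj₁ (from (seen-⇔ σ i) (k , refl , r , j , s , q)))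

  seen-carried : ∀ σ i → seen σ (next i) ≡ ρ i ∧ (seen σ i ∨ σ i)
  seen-carried σ i = does-⇔ (mk⇔ forth back) (before? σ (next i)) (T? (ρ i) ×-dec T? (seen σ i ∨ σ i))
    where
    forth : (∃[ k ] next k ≡ next i × T (ρ k) × Ends σ k) → T (ρ i) × T (seen σ i ∨ σ i)
    forth (k , eq , r , p) with next-injective eq
    ... | refl = r , from (seen∨⇔Ends σ i) p
    back : T (ρ i) × T (seen σ i ∨ σ i) → ∃[ k ] next k ≡ next i × T (ρ k) × Ends σ k
    back (r , t) = i , refl , r , to (seen∨⇔Ends σ i) t

  module CutRuns {z} (cut : Cut z) where

    -- Walking along `next` from `i` eventually meets the cut `z`; the run stops at the first cut on
    -- the way.
    runToCut : ∀ i → ∃[ e ] i ⟶* e × Cut e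
    runToCut i = toCut (next-induction (Star (λ i j → next i ≡ j) i) ε (λ j p → p ◅◅ refl ◅ ε) z)
      where
      toCut : ∀ {i} → Star (λ i j → next i ≡ j) i z → ∃[ e ] i ⟶* e × Cut e
      toCut ε = z , ε , cut
      toCut {i} (refl ◅ p) with T? (ρ i)
      ... | no c  = i , ε , c
      ... | yes r with toCut p
      ...   | e , q , c = e , (r , refl) ◅ q , c

    -- Serves as the name of a rim path: two vertices lie on the same path exactly when their ends
    -- agree.
    end : Fin n → Fin n
    end i = proj₁ (runToCut i)

    run : ∀ i → i ⟶* end i
    run i = proj₁ (proj₂ (runToCut i))

    end-cut : ∀ i → Cut (end i)
    end-cut i = proj₂ (proj₂ (runToCut i))

    -- Drops by one along every step, which shows that the vertices of a run are distinct and that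
    -- no nonempty run returns to its start.
    height : Fin n → ℕ
    height i = length (run i)

    end-run : ∀ {i e} → i ⟶* e → Cut e → end i ≡ e
    end-run p c = proj₁ (runs-to-cuts-agree (run _) p (end-cut _) c)

    end-⟶ : ∀ {i j} → i ⟶ j → end i ≡ end j
    end-⟶ {j = j} s = end-run (s ◅ run j) (end-cut j)

    height-⟶ : ∀ {i j} → i ⟶ j → height i ≡ suc (height j)
    height-⟶ {i} {j} s = proj₂ (runs-to-cuts-agree (run i) (s ◅ run j) (end-cut i) (end-cut j))

    height-⟶* : ∀ {i j} → i ⟶* j → height j ≤ height i
    height-⟶* ε       = ℕ.≤-refl
    height-⟶* (s ◅ p) = subst (_ ≤_) (sym (height-⟶ s)) (ℕ.m≤n⇒m≤1+n (height-⟶* p))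

    one-per-run : ∀ {σ x} → Seen σ x → ∀ {i j} → end i ≡ end j → T (σ i) → T (σ j) → i ≡ j
    one-per-run X {i} {j} eq s t with comparable (run i) (subst (j ⟶*_) (sym eq) (run j))
    ... | inj₁ p = Seen.path-trivial X p s t
    ... | inj₂ p = sym (Seen.path-trivial X p t s)

-- At a cut `i`, the bits `x i ∨ σ i` and `y i ∨ τ i` tell whether the rim path ending in `i` has a
-- spoke and whether it has a root. By `nonempty` each path is joined to a root or to the centre,
-- and by `marked` the centre is joined to exactly one root.
record Labelling {n} (ρ σ τ x y : Fin n → Bool) : Set where
  open Runs ρ
  field
    spokes   : Seen σ x
    roots    : Seen τ y
    nonempty : ∀ i → Cut i → T (x i ∨ σ i) ⊎ T (y i ∨ τ i)
    marked   : ∃! _≡_ λ i → Cut i × T (x i ∨ σ i) × T (y i ∨ τ i)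

-- Rooted forests of the wheel as labellings of the rim

T-lookup : ∀ {n} {S : Subset n} {e} → e ∈ S ⇔ T (lookup S e)
T-lookup {S = S} {e} = mk⇔ (λ p → from T-≡ ([]=⇒lookup p))
                           (λ t → lookup⇒[]= e S (to T-≡ t))

rimBits spokeBits : ∀ {N} → Subset (N + N) → Fin N → Bool
rimBits   {N} S i = lookup S (i ↑ˡ N)
spokeBits {N} S i = lookup S (N ↑ʳ i)

rootBits : ∀ {N} → Subset (suc N) → Fin N → Bool
rootBits R i = lookup R (suc i)

module WheelForests {N : ℕ} (3≤N : 3 ≤ N) (S : Subset (N + N)) (R : Subset (suc N)) (c∉R : zero ∉ R) where

  G : Graph
  G = wheel N 3≤N

  ρ σ τ : Fin N → Bool
  ρ = rimBits S
  σ = spokeBits S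
  τ = rootBits R

  open Runs ρ

  infix 4 _~_ _~*_

  _~_ _~*_ : Fin (suc N) → Fin (suc N) → Set
  _~_  = Adjacent G S
  _~*_ = Connected G S

  data Edge : Fin (suc N) → Fin (suc N) → Set where
    right : ∀ {i j} → i ⟶ j → Edge (suc i) (suc j)
    left  : ∀ {i j} → i ⟶ j → Edge (suc j) (suc i)
    out   : ∀ {i} → T (σ i) → Edge zero (suc i)
    back  : ∀ {i} → T (σ i) → Edge (suc i) zero

  edge : ∀ {u v} → u ~ v → Edge u v
  edge (e , e∈S , joins) with splitAt N e in eq | joins
  ... | inj₁ i | inj₁ refl = right (rim , refl)
    where rim = to T-lookup (subst (_∈ S) (sym (splitAt⁻¹-↑ˡ eq)) e∈S)
  ... | inj₁ i | inj₂ refl = left (rim , refl)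
    where rim = to T-lookup (subst (_∈ S) (sym (splitAt⁻¹-↑ˡ eq)) e∈S)
  ... | inj₂ i | inj₁ refl = out (to T-lookup (subst (_∈ S) (sym (splitAt⁻¹-↑ʳ {m = N} eq)) e∈S))
  ... | inj₂ i | inj₂ refl = back (to T-lookup (subst (_∈ S) (sym (splitAt⁻¹-↑ʳ {m = N} eq)) e∈S))

  ~-sym : ∀ {u v} → u ~ v → v ~ u
  ~-sym (e , e∈S , joins) = e , e∈S , Sum.swap joins

  ~-resp : ∀ {u u′ v} → u ≡ u′ → u ~ v → u′ ~ v
  ~-resp refl e = e

  ~*-sym : ∀ {u v} → u ~* v → v ~* u
  ~*-sym = reverse ~-sym

  rim-~ : ∀ {i j} → i ⟶ j → suc i ~ suc j
  rim-~ {i} (r , refl) = i ↑ˡ N , from T-lookup r , inj₁ (cong wheelEdge (splitAt-↑ˡ N i N))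

  spoke-~ : ∀ {i} → T (σ i) → zero ~ suc i
  spoke-~ {i} s = N ↑ʳ i , from T-lookup s , inj₁ (cong wheelEdge (splitAt-↑ʳ N N i))

  rim-~* : ∀ {i j} → i ⟶* j → suc i ~* suc j
  rim-~* = gmap suc rim-~

  root-∈ : ∀ {i} → T (τ i) ⇔ suc i ∈ R
  root-∈ = mk⇔ (from T-lookup) (to T-lookup)

  -- From a rooted forest to a labelling

  module FromForest (forest : IsRootedForest G S R) where

    acyclic : Acyclic G S
    acyclic = proj₁ forest

    rootOf : ∀ v → ∃[ r ] T (τ r) × v ~* suc r
    rootOf v with proj₂ forest v
    ... | zero  , (c∈R , _) , _ = contradiction c∈R c∉R
    ... | suc r , (r∈R , p) , _ = r , from root-∈ r∈R , p

    root-unique : ∀ {v r s} → T (τ r) → T (τ s) → v ~* suc r → v ~* suc s → r ≡ s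
    root-unique {v} t u p q with proj₂ forest v
    ... | _ , _ , unique = suc-injective (trans (sym (unique (to root-∈ t , p))) (unique (to root-∈ u , q)))

    rim-has-cut : ∃[ z ] Cut z
    rim-has-cut = ¬∀⟶∃¬ N _ (λ i → T? (ρ i)) λ r → rim-cycle 3≤N r acyclic
      where
      rim-cycle : 3 ≤ N → (∀ i → T (ρ i)) → ¬ Acyclic G S
      rim-cycle (s≤s (s≤s (s≤s _))) r acyclic = acyclic (_ , tabulate suc , Unique.tabulate⁺ suc-injective ,
        λ i → subst₂ _~_ (sym (lookup∘tabulate suc i)) (sym (lookup∘tabulate suc (next i))) (rim-~ (r i , refl)))

    cut : Cut (proj₁ rim-has-cut)
    cut = proj₂ rim-has-cut

    open CutRuns cut

    vertices : ∀ {i j} (p : i ⟶* j) → Vec (Fin N) (suc (length p))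
    vertices {i} ε       = i ∷ []
    vertices {i} (_ ◅ p) = i ∷ vertices p

    vertices-height : ∀ {i j} (p : i ⟶* j) → All (λ k → height k ≤ height i) (vertices p)
    vertices-height ε       = ℕ.≤-refl ∷ []
    vertices-height (s ◅ p) = ℕ.≤-refl ∷
      All.map (λ le → ℕ.≤-trans le (height-⟶* (s ◅ ε))) (vertices-height p)

    vertices-unique : ∀ {i j} (p : i ⟶* j) → Unique (vertices p)
    vertices-unique ε       = [] ∷ []
    vertices-unique (s ◅ p) =
      All.map (λ { le refl → ℕ.1+n≰n (subst (_≤ _) (height-⟶ s) le) }) (vertices-height p) ∷ vertices-unique p

    vertices-first : ∀ {i j} (p : i ⟶* j) → lookup (vertices p) zero ≡ i
    vertices-first ε       = refl
    vertices-first (_ ◅ _) = refl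

    vertices-last : ∀ {i j} (p : i ⟶* j) → lookup (vertices p) (fromℕ (length p)) ≡ j
    vertices-last ε       = refl
    vertices-last (_ ◅ p) = vertices-last p

    vertices-step : ∀ {i j} (p : i ⟶* j) k → lookup (vertices p) (inject₁ k) ⟶ lookup (vertices p) (suc k)
    vertices-step (s ◅ p) zero    = subst (_ ⟶_) (sym (vertices-first p)) s
    vertices-step (s ◅ p) (suc k) = vertices-step p k

    -- Two spokes to different vertices of one rim path close a cycle through the centre. The first
    -- step is given apart from the rest so that the cycle visibly has at least three vertices.
    spoke-cycle : ∀ {i j k} → i ⟶ j → j ⟶* k → T (σ i) → T (σ k) → ¬ Acyclic G S
    spoke-cycle {i} {j} {k} s p si sk acyclic = acyclic (_ , cycle , unique , closed)
      where
      q = s ◅ p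
      rim = Vec.map suc (vertices q)
      cycle = zero ∷ rim
      unique : Unique cycle
      unique = All.map⁺ (All.universal (λ _ ()) (vertices q)) ∷ Unique.map⁺ suc-injective (vertices-unique q)
      closed : ∀ l → lookup cycle l ~ lookup cycle (next l)
      closed l with view l
      ... | ‵fromℕ = subst₂ _~_ (sym (trans (lookup-map (fromℕ _) suc (vertices q)) (cong suc (vertices-last q))))
                                (cong (lookup cycle) (sym (next-fromℕ _))) (~-sym (spoke-~ sk))
      ... | ‵inject₁ m = subst (λ v → lookup cycle (inject₁ m) ~ lookup cycle v) (sym (next-inject₁ m)) (consecutive m)
        where
        consecutive : ∀ m → lookup cycle (inject₁ m) ~ lookup rim m
        consecutive zero    = spoke-~ si
        consecutive (suc m) = subst₂ _~_ (sym (lookup-map (inject₁ m) suc (vertices q)))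
          (sym (lookup-map (suc m) suc (vertices q))) (rim-~ (vertices-step q m))

    -- On the walk from `i` to its root, everything before the first use of a spoke stays on the rim
    -- path that ends in `i`; the second argument of `search` records this.
    run-has-spoke-or-root : ∀ {i} → Cut i → Ends σ i ⊎ Ends τ i
    run-has-spoke-or-root {i} ci with rootOf (suc i)
    ... | r , t , p = search p ε
      where
      search : ∀ {j} → suc j ~* suc r → j ⟶* i → Ends σ i ⊎ Ends τ i
      search ε       q = inj₂ (r , t , q)
      search {j} (e ◅ p) q with edge e
      ... | left s   = search p (s ◅ q)
      ... | back s   = inj₁ (j , s , q)
      ... | right (s , refl) with q
      ...   | ε               = contradiction s ci
      ...   | (_ , refl) ◅ q′ = search p q′

    -- After its last visit to the centre, the walk from the centre to its root takes a spoke and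
    -- stays on one rim path, which therefore has both a spoke and the root. `fromRim` either meets
    -- the centre again or finds the root on the current path.
    marked-cut : ∃[ i ] Cut i × Ends σ i × Ends τ i
    marked-cut with rootOf zero
    ... | r , t , p = fromCentre p
      where
      Goal = ∃[ i ] Cut i × Ends σ i × Ends τ i
      fromCentre : zero ~* suc r → Goal
      fromRim : ∀ {j} → suc j ~* suc r → Goal ⊎ ∃[ k ] T (τ k) × end k ≡ end j
      fromCentre (e ◅ p) with edge e
      ... | out {j} s with fromRim p
      ...   | inj₁ g            = g
      ...   | inj₂ (k , t , eq) = end j , end-cut j , (j , s , run j) , (k , t , subst (k ⟶*_) eq (run k))
      fromRim ε = inj₂ (r , t , refl)
      fromRim (e ◅ p) with edge e
      ... | back _  = inj₁ (fromCentre p)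
      ... | right s = Sum.map₂ (λ { (k , t , eq) → k , t , trans eq (sym (end-⟶ s)) }) (fromRim p)
      ... | left s  = Sum.map₂ (λ { (k , t , eq) → k , t , trans eq (end-⟶ s) }) (fromRim p)

    -- Both roots are connected to the centre, hence equal, and a root lies on only one path.
    marked-cut-unique : ∀ {i j} → Cut i → Ends σ i → Ends τ i → Cut j → Ends σ j → Ends τ j → i ≡ j
    marked-cut-unique ci (a , s , p) (r , t , q) cj (b , s′ , p′) (r′ , t′ , q′)
      with root-unique {zero} t t′ (spoke-~ s ◅ rim-~* p ◅◅ ~*-sym (rim-~* q))
                                  (spoke-~ s′ ◅ rim-~* p′ ◅◅ ~*-sym (rim-~* q′))
    ... | refl = proj₁ (runs-to-cuts-agree q q′ ci cj)

    spokes-seen : Seen σ (seen σ)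
    spokes-seen = record { carried = seen-carried σ ; disjoint = disjoint }
      where
      disjoint : ∀ i → T (seen σ i) → ¬ T (σ i)
      disjoint i t s with to (seen-⇔ σ i) t
      -- The first step that `spoke-cycle` asks for is the one into `i` if the run before it is
      -- empty, and otherwise the one that opens this run.
      ... | k , eq , r , j , s′ , ε     = spoke-cycle (r , eq) ε s′ s acyclic
      ... | k , eq , r , j , s′ , q ◅ p = spoke-cycle q (p ◅◅ (r , eq) ◅ ε) s′ s acyclic

    roots-seen : Seen τ (seen τ)
    roots-seen = record { carried = seen-carried τ ; disjoint = disjoint }
      where
      disjoint : ∀ i → T (seen τ i) → ¬ T (τ i)
      disjoint i t u with to (seen-⇔ τ i) t
      ... | k , eq , r , j , t′ , p with root-unique t′ u ε (rim-~* (p ◅◅ (r , eq) ◅ ε))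
      -- The two roots coincide, so a nonempty run would return to its own start, against the drop
      -- of `height`.
      ...   | refl = ℕ.1+n≰n (subst (_≤ _) (height-⟶ (r , eq)) (height-⟶* p))

    labelling : Labelling ρ σ τ (seen σ) (seen τ)
    labelling = record
      { spokes   = spokes-seen
      ; roots    = roots-seen
      ; nonempty = λ i c → Sum.map (seen∨ σ i) (seen∨ τ i) (run-has-spoke-or-root c)
      ; marked   = let i , c , s , t = marked-cut in
          i , (c , seen∨ σ i s , seen∨ τ i t) ,
          λ {j} (c′ , s′ , t′) → marked-cut-unique c s t c′ (ends σ j s′) (ends τ j t′)
      }
      where
      seen∨ : ∀ φ i → Ends φ i → T (seen φ i ∨ φ i)
      seen∨ φ i = from (seen∨⇔Ends φ i)
      ends : ∀ φ i → T (seen φ i ∨ φ i) → Ends φ i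
      ends φ i = to (seen∨⇔Ends φ i)

  -- From a labelling to a rooted forest

  module ToForest {x y} (L : Labelling ρ σ τ x y) where
    open Labelling L

    cut : Cut (proj₁ marked)
    cut = proj₁ (proj₁ (proj₂ marked))

    open CutRuns cut

    -- A path with both a spoke and a root must end at the one marked cut.
    marked-ends-agree : ∀ {r a s b} → T (τ r) → T (σ a) → end a ≡ end r → T (τ s) → T (σ b) → end b ≡ end s → end r ≡ end s
    marked-ends-agree t sa p t′ sb p′ = trans (sym (marked-end t sa p)) (marked-end t′ sb p′)
      where
      marked-end : ∀ {r a} → T (τ r) → T (σ a) → end a ≡ end r → proj₁ marked ≡ end r
      marked-end {r} {a} t sa p = proj₂ (proj₂ marked)
        ( end-cut r
        , Seen.complete spokes (subst (a ⟶*_) p (run a)) (Seen.from-mark spokes sa)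
        , Seen.complete roots (run r) (Seen.from-mark roots t))

    -- Invariant of walks from the root `r`: they meet the centre only if the path of `r` has a
    -- spoke, and another path only if that path has a spoke as well.
    Reach : Fin N → Fin (suc N) → Set
    Reach r zero    = ∃[ a ] T (σ a) × end a ≡ end r
    Reach r (suc i) = end i ≡ end r ⊎ Reach r zero × ∃[ a ] T (σ a) × end a ≡ end i

    reach : ∀ {r u v} → Reach r u → u ~* v → Reach r v
    reach q ε       = q
    reach q (e ◅ p) with edge e | q
    ... | out {i} s | q              = reach (inj₂ (q , i , s , refl)) p
    ... | back {i} s | inj₁ eq       = reach (i , s , eq) p
    ... | back s | inj₂ (q , _)      = reach q p
    ... | right s | inj₁ eq          = reach (inj₁ (trans (sym (end-⟶ s)) eq)) p
    ... | right s | inj₂ (q , a , t , eq) = reach (inj₂ (q , a , t , trans eq (end-⟶ s))) p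
    ... | left s | inj₁ eq           = reach (inj₁ (trans (end-⟶ s) eq)) p
    ... | left s | inj₂ (q , a , t , eq)  = reach (inj₂ (q , a , t , trans eq (sym (end-⟶ s)))) p

    -- Either both roots lie on one path, or each lies on a path with a spoke; in the latter case
    -- the two paths agree by `marked-ends-agree`. A path has at most one root.
    roots-disconnected : ∀ {r s} → T (τ r) → T (τ s) → suc r ~* suc s → r ≡ s
    roots-disconnected {r} t u p with reach {r} (inj₁ refl) p
    ... | inj₁ eq = one-per-run roots (sym eq) t u
    ... | inj₂ ((a , sa , eq) , b , sb , eq′) = one-per-run roots (marked-ends-agree t sa eq u sb eq′) t u

    centre-root : ∃[ r ] T (τ r) × zero ~* suc r
    centre-root with proj₁ (proj₂ marked)
    ... | _ , s , t with Seen.sound spokes cut _ s | Seen.sound roots cut _ t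
    ...   | a , sa , p | r , tr , q = r , tr , spoke-~ sa ◅ rim-~* p ◅◅ ~*-sym (rim-~* q)

    rootOf : ∀ v → ∃[ r ] T (τ r) × v ~* suc r
    rootOf zero = centre-root
    rootOf (suc i) with nonempty (end i) (end-cut i)
    ... | inj₂ t with Seen.sound roots cut _ t
    ...   | r , tr , q = r , tr , rim-~* (run i) ◅◅ ~*-sym (rim-~* q)
    rootOf (suc i) | inj₁ s with Seen.sound spokes cut _ s | centre-root
    ...   | a , sa , q | r , tr , p = r , tr , rim-~* (run i) ◅◅ ~*-sym (rim-~* q) ◅◅ ~-sym (spoke-~ sa) ◅ p

    root : ∀ v → ∃! _≡_ λ r → r ∈ R × v ~* r
    root v with rootOf v
    ... | r , t , p = suc r , (to root-∈ t , p) , unique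
      where
      unique : ∀ {s} → s ∈ R × v ~* s → suc r ≡ s
      unique {zero}  (c∈R , _) = contradiction c∈R c∉R
      unique {suc s} (s∈R , q) = cong suc (roots-disconnected t (from root-∈ s∈R) (~*-sym p ◅◅ q))

    module _ {k} {vs : Vec (Fin (suc N)) (3 + k)} (cycle : IsCycle G S vs) where

      lookup-inj : ∀ {l m} → lookup vs l ≡ lookup vs m → l ≡ m
      lookup-inj = Unique.lookup-injective (proj₁ cycle) _ _

      3≤3+k : 3 ≤ 3 + k
      3≤3+k = s≤s (s≤s (s≤s z≤n))

      Visited : Fin N → Set
      Visited i = ∃[ l ] lookup vs l ≡ suc i

      module _ (c∉vs : ∀ l → lookup vs l ≢ zero) where

        -- The two neighbours of a vertex on the cycle are distinct, so away from the centre they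
        -- cannot both be the rim predecessor of `i`; one of them is `next i`.
        visited-⟶ : ∀ {i} → Visited i → i ⟶ next i × Visited (next i)
        visited-⟶ {i} (l , eq) with next-surjective l
        ... | m , refl = go (~-resp eq (proj₂ cycle (next m)))
                            (~-resp eq (~-sym (proj₂ cycle m))) refl refl
          where
          go : ∀ {u v} → suc i ~ u → suc i ~ v → lookup vs (next (next m)) ≡ u → lookup vs m ≡ v →
               i ⟶ next i × Visited (next i)
          go e f p q with edge e | edge f
          ... | right s@(_ , refl) | _                  = s , _ , p
          ... | left _             | right s@(_ , refl) = s , _ , q
          ... | left (_ , a)       | left (_ , b)       =
            contradiction (lookup-inj (trans q (trans (cong suc (next-injective (trans b (sym a)))) (sym p))))
                          (next²≢ 3≤3+k m)
          ... | back _             | _                  = contradiction p (c∉vs _)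
          ... | left _             | back _             = contradiction q (c∉vs _)

        visited-somewhere : ∃[ i ] Visited i
        visited-somewhere with lookup vs zero in eq
        ... | zero  = contradiction eq (c∉vs zero)
        ... | suc i = i , zero , eq

        all-visited : ∀ i → Visited i
        all-visited = next-induction Visited (proj₂ visited-somewhere) (λ i v → proj₂ (visited-⟶ v))

        rim-full : ∀ i → T (ρ i)
        rim-full i = proj₁ (proj₁ (visited-⟶ (all-visited i)))

      module _ {l} (eq : lookup vs l ≡ zero) where

        neighbour : ∀ {m} → zero ~ lookup vs m → ∃[ a ] T (σ a) × lookup vs m ≡ suc a
        neighbour {m} e with lookup vs m | edge e
        ... | suc a | out s = a , s , refl

        after : ∃[ a ] T (σ a) × lookup vs (next l) ≡ suc a
        after = neighbour (~-resp eq (proj₂ cycle l))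

        -- Between leaving the centre and returning to it, the cycle cannot leave the rim path that
        -- it entered.
        SameRun : Fin (3 + k) → Set
        SameRun m = m ≡ l ⊎ ∃[ b ] lookup vs m ≡ suc b × end b ≡ end (proj₁ after)

        same-run : ∀ m → SameRun m
        same-run = next-induction SameRun (inj₂ (proj₁ after , proj₂ (proj₂ after) , refl)) step
          where
          step : ∀ m → SameRun m → SameRun (next m)
          step m (inj₁ refl)           = inj₂ (proj₁ after , proj₂ (proj₂ after) , refl)
          step m (inj₂ (b , p , same)) = go (~-resp p (proj₂ cycle m)) refl
            where
            go : ∀ {u} → suc b ~ u → lookup vs (next m) ≡ u → SameRun (next m)
            go e q with edge e
            ... | right s = inj₂ (_ , q , trans (sym (end-⟶ s)) same)
            ... | left s  = inj₂ (_ , q , trans (end-⟶ s) same)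
            ... | back _  = inj₁ (lookup-inj (trans q (sym eq)))

        two-spokes : ∀ m → next m ≢ l
        two-spokes m refl with neighbour (~-resp eq (~-sym (proj₂ cycle m))) | same-run m
        ... | _           | inj₁ m≡l = next≢ 3≤3+k m m≡l
        ... | a , sa , p | inj₂ (b , q , same) with trans (sym p) q
        -- The spokes of departure and return go to the same vertex, so the centre has equal
        -- neighbours on the cycle, which its length of at least three excludes.
        ...   | refl = next²≢ 3≤3+k m
          (lookup-inj (trans p (trans (cong suc (one-per-run spokes same sa (proj₁ (proj₂ after)))) (sym (proj₂ (proj₂ after))))))

      -- A cycle avoiding the centre would use every rim edge, including the missing one; a cycle
      -- through the centre would need two spokes to one path.
      no-cycle : ⊥
      no-cycle with any? (λ l → lookup vs l ≟ zero)
      ... | yes (l , eq) = let m , p = next-surjective l in two-spokes eq m p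
      ... | no ∄         = cut (rim-full (λ l eq → ∄ (l , eq)) _)

    forest : IsRootedForest G S R
    forest = (λ (k , vs , cycle) → no-cycle cycle) , root

  forest⇔labelling : IsRootedForest G S R ⇔ (∃[ x ] ∃[ y ] Labelling ρ σ τ x y)
  forest⇔labelling = mk⇔ (λ f → _ , _ , FromForest.labelling f) (λ (_ , _ , L) → ToForest.forest L)

-- Transfer matrices over the dual numbers

infixl 6 _⊕_
infixl 7 _⊗_

-- Dual numbers: (a , b) stands for a + bε with ε² = 0.
𝔻 : Set
𝔻 = ℕ × ℕ

0𝔻 1𝔻 : 𝔻
0𝔻 = 0 , 0
1𝔻 = 1 , 0

_⊕_ _⊗_ : 𝔻 → 𝔻 → 𝔻
(a , b) ⊕ (c , d) = a + c , b + d
(a , b) ⊗ (c , d) = a * c , a * d + b * c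

⊕-identityʳ : ∀ u → u ⊕ 0𝔻 ≡ u
⊕-identityʳ (a , b) = cong₂ _,_ (ℕ.+-identityʳ a) (ℕ.+-identityʳ b)

⊕-interchange : ∀ u v w z → (u ⊕ v) ⊕ (w ⊕ z) ≡ (u ⊕ w) ⊕ (v ⊕ z)
⊕-interchange (a , a′) (b , b′) (c , c′) (d , d′) = cong₂ _,_ (eq a b c d) (eq a′ b′ c′ d′)
  where
  eq : ∀ a b c d → (a + b) + (c + d) ≡ (a + c) + (b + d)
  eq = solve 4 (λ a b c d → (a :+ b) :+ (c :+ d) := (a :+ c) :+ (b :+ d)) refl

⊗-comm : ∀ u v → u ⊗ v ≡ v ⊗ u
⊗-comm (a , a′) (b , b′) = cong₂ _,_ (ℕ.*-comm a b)
  (solve 4 (λ a a′ b b′ → a :* b′ :+ a′ :* b := b :* a′ :+ b′ :* a) refl a a′ b b′)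

⊗-assoc : ∀ u v w → (u ⊗ v) ⊗ w ≡ u ⊗ (v ⊗ w)
⊗-assoc (a , a′) (b , b′) (c , c′) = cong₂ _,_ (ℕ.*-assoc a b c)
  (solve 6 (λ a a′ b b′ c c′ → (a :* b) :* c′ :+ (a :* b′ :+ a′ :* b) :* c := a :* (b :* c′ :+ b′ :* c) :+ a′ :* (b :* c))
    refl a a′ b b′ c c′)

⊗-distribˡ-⊕ : ∀ u v w → u ⊗ (v ⊕ w) ≡ u ⊗ v ⊕ u ⊗ w
⊗-distribˡ-⊕ (a , a′) (b , b′) (c , c′) = cong₂ _,_ (ℕ.*-distribˡ-+ a b c)
  (solve 6 (λ a a′ b b′ c c′ → a :* (b′ :+ c′) :+ a′ :* (b :+ c) := (a :* b′ :+ a′ :* b) :+ (a :* c′ :+ a′ :* c))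
    refl a a′ b b′ c c′)

⊗-distribʳ-⊕ : ∀ u v w → (v ⊕ w) ⊗ u ≡ v ⊗ u ⊕ w ⊗ u
⊗-distribʳ-⊕ u v w = trans (⊗-comm (v ⊕ w) u) (trans (⊗-distribˡ-⊕ u v w) (cong₂ _⊕_ (⊗-comm u v) (⊗-comm u w)))

⊗-identityˡ : ∀ u → 1𝔻 ⊗ u ≡ u
⊗-identityˡ (a , b) = cong₂ _,_ (ℕ.+-identityʳ a) (trans (ℕ.+-identityʳ _) (ℕ.+-identityʳ b))

module _ {A : Set} (_∙_ : A → A → A) where
  -- Generic in the operation, so that sums in `ℕ` and in `𝔻` are related by the homomorphism
  -- `proj₂` through `bitSum-map`.
  bitSum : ∀ n → (Vec Bool n → A) → A
  bitSum zero    f = f []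
  bitSum (suc n) f = bitSum n (f ∘ (false ∷_)) ∙ bitSum n (f ∘ (true ∷_))

  bitSum-cong : ∀ n {f g : Vec Bool n → A} → (∀ v → f v ≡ g v) → bitSum n f ≡ bitSum n g
  bitSum-cong zero    f≗g = f≗g []
  bitSum-cong (suc n) f≗g = cong₂ _∙_ (bitSum-cong n (f≗g ∘ (false ∷_))) (bitSum-cong n (f≗g ∘ (true ∷_)))

  bitSum-++ : ∀ m n (f : Vec Bool (m + n) → A) → bitSum (m + n) f ≡ bitSum m λ u → bitSum n λ v → f (u Vec.++ v)
  bitSum-++ zero    n f = refl
  bitSum-++ (suc m) n f = cong₂ _∙_ (bitSum-++ m n (f ∘ (false ∷_))) (bitSum-++ m n (f ∘ (true ∷_)))

bitSum-map : {A B : Set} {_∙_ : A → A → A} {_∘′_ : B → B → B} (h : A → B) → (∀ a b → h (a ∙ b) ≡ h a ∘′ h b) →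
  ∀ n f → h (bitSum _∙_ n f) ≡ bitSum _∘′_ n (h ∘ f)
bitSum-map h hom zero    f = refl
bitSum-map {_∘′_ = _∘′_} h hom (suc n) f =
  trans (hom _ _) (cong₂ _∘′_ (bitSum-map h hom n (f ∘ (false ∷_))) (bitSum-map h hom n (f ∘ (true ∷_))))

∑ : ∀ n → (Vec Bool n → 𝔻) → 𝔻
∑ = bitSum _⊕_

∑-cong : ∀ n {f g : Vec Bool n → 𝔻} → (∀ v → f v ≡ g v) → ∑ n f ≡ ∑ n g
∑-cong = bitSum-cong _⊕_

∑-⊕ : ∀ n (f g : Vec Bool n → 𝔻) → ∑ n (λ v → f v ⊕ g v) ≡ ∑ n f ⊕ ∑ n g
∑-⊕ zero    f g = refl
∑-⊕ (suc n) f g = trans (cong₂ _⊕_ (∑-⊕ n _ _) (∑-⊕ n _ _))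
  (⊕-interchange (∑ n (f ∘ (false ∷_))) (∑ n (g ∘ (false ∷_))) (∑ n (f ∘ (true ∷_))) (∑ n (g ∘ (true ∷_))))

∑-comm : ∀ m n (f : Vec Bool m → Vec Bool n → 𝔻) → (∑ m λ u → ∑ n λ v → f u v) ≡ (∑ n λ v → ∑ m λ u → f u v)
∑-comm zero    n f = refl
∑-comm (suc m) n f = trans (cong₂ _⊕_ (∑-comm m n _) (∑-comm m n _)) (sym (∑-⊕ n _ _))

⊗-∑ : ∀ n a f → a ⊗ ∑ n f ≡ ∑ n λ v → a ⊗ f v
⊗-∑ n a f = bitSum-map (a ⊗_) (⊗-distribˡ-⊕ a) n f

∑-ε : ∀ n f → proj₂ (∑ n f) ≡ bitSum _+_ n (proj₂ ∘ f)
∑-ε n f = bitSum-map proj₂ (λ _ _ → refl) n f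

∑-0 : ∀ n → ∑ n (λ _ → 0𝔻) ≡ 0𝔻
∑-0 zero    = refl
∑-0 (suc n) = cong₂ _⊕_ (∑-0 n) (∑-0 n)

-- The identity matrix, which is the transfer matrix of the empty word.
δ : Vec Bool n → Vec Bool n → 𝔻
δ []          []          = 1𝔻
δ (false ∷ u) (false ∷ v) = δ u v
δ (false ∷ u) (true  ∷ v) = 0𝔻
δ (true  ∷ u) (false ∷ v) = 0𝔻
δ (true  ∷ u) (true  ∷ v) = δ u v

∑-δ : ∀ n u (f : Vec Bool n → 𝔻) → ∑ n (λ v → δ u v ⊗ f v) ≡ f u
∑-δ zero    []          f = ⊗-identityˡ (f [])
∑-δ (suc n) (false ∷ u) f = trans (cong₂ _⊕_ (∑-δ n u _) (∑-0 n)) (⊕-identityʳ _)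
∑-δ (suc n) (true  ∷ u) f = cong₂ _⊕_ (∑-0 n) (∑-δ n u _)

-- The rim edge to the next vertex, the spoke and the root bit of a rim vertex.
Letter : Set
Letter = Bool × Bool × Bool

-- Whether the current rim path has met a spoke, and whether it has met a root.
State : Set
State = Vec Bool 2

-- A missing rim edge ends the current path, so both bits are cleared for the next vertex.
step : Letter → State → State
step (r , s , t) (x ∷ y ∷ []) = r ∧ (x ∨ s) ∷ r ∧ (y ∨ t) ∷ []

-- `valid` refuses a second spoke, a second root and the end of a path that has neither; `marking`
-- singles out the end of a path that has both.
valid marking : Letter → State → Bool
valid   (r , s , t) (x ∷ y ∷ []) = not (x ∧ s) ∧ not (y ∧ t) ∧ (r ∨ ((x ∨ s) ∨ (y ∨ t)))
marking (r , s , t) (x ∷ y ∷ []) = not r ∧ (x ∨ s) ∧ (y ∨ t)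

bit : Bool → ℕ
bit b = if b then 1 else 0

-- As ε² = 0, the ε-coefficient of a product of weights is 1 exactly when all letters are valid and
-- a single one is marking.
weight : Letter → State → 𝔻
weight l p = bit (valid l p ∧ not (marking l p)) , bit (valid l p ∧ marking l p)

wordWeight : Vec Letter n → State → State → 𝔻
wordWeight []       p q = δ p q
wordWeight (l ∷ ls) p q = weight l p ⊗ wordWeight ls (step l p) q

letters : (ts rs ss : Vec Bool n) → Vec Letter n
letters []       []       []       = []
letters (t ∷ ts) (r ∷ rs) (s ∷ ss) = (r , s , t) ∷ letters ts rs ss

lookup-letters : ∀ (ts rs ss : Vec Bool n) i → lookup (letters ts rs ss) i ≡ (lookup rs i , lookup ss i , lookup ts i)
lookup-letters (t ∷ ts) (r ∷ rs) (s ∷ ss) zero    = refl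
lookup-letters (t ∷ ts) (r ∷ rs) (s ∷ ss) (suc i) = lookup-letters ts rs ss i

∑∑ : (Bool → Bool → 𝔻) → 𝔻
∑∑ f = (f false false ⊕ f false true) ⊕ (f true false ⊕ f true true)

∑∑-cong : ∀ {f g} → (∀ r s → f r s ≡ g r s) → ∑∑ f ≡ ∑∑ g
∑∑-cong f≗g = cong₂ _⊕_ (cong₂ _⊕_ (f≗g false false) (f≗g false true)) (cong₂ _⊕_ (f≗g true false) (f≗g true true))

∑∑-∑ : ∀ n (f : Bool → Bool → Vec Bool n → 𝔻) → ∑∑ (λ r s → ∑ n (f r s)) ≡ ∑ n λ u → ∑∑ λ r s → f r s u
∑∑-∑ n f = sym (trans (∑-⊕ n (λ u → f false false u ⊕ f false true u) (λ u → f true false u ⊕ f true true u))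
  (cong₂ _⊕_ (∑-⊕ n (f false false) (f false true)) (∑-⊕ n (f true false) (f true true))))

∑∑-⊗ : ∀ a f → ∑∑ f ⊗ a ≡ ∑∑ λ r s → f r s ⊗ a
∑∑-⊗ a f = trans (⊗-distribʳ-⊕ a (f false false ⊕ f false true) (f true false ⊕ f true true))
  (cong₂ _⊕_ (⊗-distribʳ-⊕ a (f false false) (f false true)) (⊗-distribʳ-⊕ a (f true false) (f true true)))

-- The root bits stay fixed while rim edges and spokes are summed out, giving one matrix factor per
-- rim vertex.
transfer : List Bool → State → State → 𝔻
transfer []       p q = δ p q
transfer (t ∷ ts) p q = ∑∑ λ r s → weight (r , s , t) p ⊗ transfer ts (step (r , s , t) p) q

∑-wordWeight : ∀ (ts : Vec Bool n) p q →
  (∑ n λ rs → ∑ n λ ss → wordWeight (letters ts rs ss) p q) ≡ transfer (toList ts) p q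
∑-wordWeight []       p q = refl
∑-wordWeight {suc n} (t ∷ ts) p q = cong₂ _⊕_ (row false) (row true)
  where
  term : ∀ r s → (∑ n λ rs → ∑ n λ ss → weight (r , s , t) p ⊗ wordWeight (letters ts rs ss) (step (r , s , t) p) q)
    ≡ weight (r , s , t) p ⊗ transfer (toList ts) (step (r , s , t) p) q
  term r s = trans (∑-cong n λ rs → sym (⊗-∑ n w _)) (trans (sym (⊗-∑ n w _)) (cong (w ⊗_) (∑-wordWeight ts _ q)))
    where w = weight (r , s , t) p
  row : ∀ r → (∑ n λ rs → ∑ (suc n) λ ss → wordWeight (letters (t ∷ ts) (r ∷ rs) ss) p q)
    ≡ weight (r , false , t) p ⊗ transfer (toList ts) (step (r , false , t) p) q
      ⊕ weight (r , true , t) p ⊗ transfer (toList ts) (step (r , true , t) p) q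
  row r = trans (∑-⊕ n _ _) (cong₂ _⊕_ (term r false) (term r true))

∑∑-matrix : ∀ n (w : Bool → Bool → 𝔻) (A : Bool → Bool → Vec Bool n → 𝔻) (B : Vec Bool n → 𝔻) →
  ∑∑ (λ r s → w r s ⊗ ∑ n λ u → A r s u ⊗ B u) ≡ ∑ n λ u → ∑∑ (λ r s → w r s ⊗ A r s u) ⊗ B u
∑∑-matrix n w A B = begin
  ∑∑ (λ r s → w r s ⊗ ∑ n λ u → A r s u ⊗ B u)
    ≡⟨ ∑∑-cong (λ r s → trans (⊗-∑ n (w r s) _) (∑-cong n λ u → sym (⊗-assoc (w r s) (A r s u) (B u)))) ⟩
  ∑∑ (λ r s → ∑ n λ u → (w r s ⊗ A r s u) ⊗ B u)
    ≡⟨ ∑∑-∑ n (λ r s u → (w r s ⊗ A r s u) ⊗ B u) ⟩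
  (∑ n λ u → ∑∑ λ r s → (w r s ⊗ A r s u) ⊗ B u)
    ≡⟨ ∑-cong n (λ u → sym (∑∑-⊗ (B u) (λ r s → w r s ⊗ A r s u))) ⟩
  (∑ n λ u → ∑∑ (λ r s → w r s ⊗ A r s u) ⊗ B u) ∎
  where open ≡-Reasoning

transfer-++ : ∀ ts us p q → transfer (ts ++ us) p q ≡ ∑ 2 λ u → transfer ts p u ⊗ transfer us u q
transfer-++ []       us p q = sym (∑-δ 2 p λ u → transfer us u q)
transfer-++ (t ∷ ts) us p q = trans
  (∑∑-cong λ r s → cong (weight (r , s , t) p ⊗_) (transfer-++ ts us (step (r , s , t) p) q))
  (∑∑-matrix 2 (λ r s → weight (r , s , t) p) (λ r s → transfer ts (step (r , s , t) p)) (λ u → transfer us u q))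

trace : List Bool → 𝔻
trace ts = ∑ 2 λ p → transfer ts p p

∑-trace : ∀ n (A B : Vec Bool n → Vec Bool n → 𝔻) → (∑ n λ p → ∑ n λ u → A p u ⊗ B u p) ≡ ∑ n λ u → ∑ n λ p → B u p ⊗ A p u
∑-trace n A B = trans (∑-comm n n _) (∑-cong n λ u → ∑-cong n λ p → ⊗-comm (A p u) (B u p))

-- tr AB = tr BA. This allows the reading of the rim to start at the first root.
trace-rotate : ∀ ts us → trace (ts ++ us) ≡ trace (us ++ ts)
trace-rotate ts us = begin
  trace (ts ++ us)
    ≡⟨ ∑-cong 2 {g = λ p → ∑ 2 λ u → transfer ts p u ⊗ transfer us u p} (λ p → transfer-++ ts us p p) ⟩
  (∑ 2 λ p → ∑ 2 λ u → transfer ts p u ⊗ transfer us u p)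
    ≡⟨ ∑-trace 2 (transfer ts) (transfer us) ⟩
  (∑ 2 λ u → ∑ 2 λ p → transfer us u p ⊗ transfer ts p u)
    ≡⟨ ∑-cong 2 {g = λ u → transfer (us ++ ts) u u} (λ u → sym (transfer-++ us ts u u)) ⟩
  trace (us ++ ts) ∎
  where open ≡-Reasoning

-- Ties a number to the truth of a proposition without asking for a decision procedure;
-- `Indicates-unique` then equates the decided forest condition with the automaton weight.
data _Indicates_ : ℕ → Set → Set₁ where
  holds : {A : Set} → A   → 1 Indicates A
  fails : {A : Set} → ¬ A → 0 Indicates A

Indicates-⇔ : ∀ {k A B} → A ⇔ B → k Indicates A → k Indicates B
Indicates-⇔ e (holds a)  = holds (to e a)
Indicates-⇔ e (fails ¬a) = fails (¬a ∘ from e)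

Indicates-× : ∀ {k l A B} → k Indicates A → l Indicates B → (k * l) Indicates (A × B)
Indicates-× (holds a)  (holds b)  = holds (a , b)
Indicates-× (holds a)  (fails ¬b) = fails (¬b ∘ proj₂)
Indicates-× (fails ¬a) _          = fails (¬a ∘ proj₁)

Indicates-⊎ : ∀ {k l A B} → (A → ¬ B) → k Indicates A → l Indicates B → (k + l) Indicates (A ⊎ B)
Indicates-⊎ d (holds a)  (holds b)  = contradiction b (d a)
Indicates-⊎ d (holds a)  (fails ¬b) = holds (inj₁ a)
Indicates-⊎ d (fails ¬a) (holds b)  = holds (inj₂ b)
Indicates-⊎ d (fails ¬a) (fails ¬b) = fails [ ¬a , ¬b ]′

Indicates-bit : ∀ b → bit b Indicates T b
Indicates-bit true  = holds tt
Indicates-bit false = fails id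

Indicates-unique : ∀ {k l A} → k Indicates A → l Indicates A → k ≡ l
Indicates-unique (holds _)  (holds _)  = refl
Indicates-unique (holds a)  (fails ¬a) = contradiction a ¬a
Indicates-unique (fails ¬a) (holds a)  = contradiction a ¬a
Indicates-unique (fails _)  (fails _)  = refl

-- Uniqueness of the index keeps the sum from exceeding 1.
Indicates-bitSum : ∀ n {f : Vec Bool n → ℕ} {A : Vec Bool n → Set} → (∀ v → f v Indicates A v) →
  (∀ {u v} → A u → A v → u ≡ v) → bitSum _+_ n f Indicates ∃ A
Indicates-bitSum zero    ind unique = Indicates-⇔ (mk⇔ ([] ,_) λ { ([] , a) → a }) (ind [])
Indicates-bitSum (suc n) ind unique = Indicates-⇔ (mk⇔
    [ (λ (v , a) → false ∷ v , a) , (λ (v , a) → true ∷ v , a) ]′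
    λ { (false ∷ v , a) → inj₁ (v , a) ; (true ∷ v , a) → inj₂ (v , a) })
  (Indicates-⊎ (λ (_ , a) (_ , b) → case-∷ (unique a b))
    (Indicates-bitSum n (ind ∘ (false ∷_)) (λ a b → tail≡ (unique a b)))
    (Indicates-bitSum n (ind ∘ (true ∷_)) (λ a b → tail≡ (unique a b))))
  where
  case-∷ : ∀ {n} {u v : Vec Bool n} → ¬ (false ∷ u ≡ true ∷ v)
  case-∷ ()
  tail≡ : ∀ {n a} {u v : Vec Bool n} → a ∷ u ≡ a ∷ v → u ≡ v
  tail≡ refl = refl

Plain Marking : Letter → State → Set
Plain   l p = T (valid l p ∧ not (marking l p))
Marking l p = T (valid l p ∧ marking l p)

Plain⇒¬Marking : ∀ l p → Plain l p → ¬ Marking l p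
Plain⇒¬Marking l p with valid l p | marking l p
... | true  | true  = λ ()
... | true  | false = λ _ ()
... | false | _     = λ ()

trajectory : Vec Letter n → State → Fin (suc n) → State
trajectory ls       p zero    = p
trajectory (l ∷ ls) p (suc i) = trajectory ls (step l p) i

trajectory-step : ∀ (ls : Vec Letter n) p i → trajectory ls p (suc i) ≡ step (lookup ls i) (trajectory ls p (inject₁ i))
trajectory-step (l ∷ ls) p zero    = refl
trajectory-step (l ∷ ls) p (suc i) = trajectory-step ls (step l p) i

trajectory-unique : ∀ (ls : Vec Letter n) (q : Fin (suc n) → State) →
  (∀ i → q (suc i) ≡ step (lookup ls i) (q (inject₁ i))) → ∀ i → q i ≡ trajectory ls (q zero) i
trajectory-unique ls       q next zero    = refl
trajectory-unique (l ∷ ls) q next (suc i) =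
  trans (trajectory-unique ls (q ∘ suc) (next ∘ suc) i) (cong (λ p → trajectory ls p i) (next zero))

-- The paths of weight 1 and of weight ε.
Run₀ Run₁ : Vec Letter n → State → State → Set
Run₀ []       p q = p ≡ q
Run₀ (l ∷ ls) p q = Plain l p × Run₀ ls (step l p) q
Run₁ []       p q = ⊥
Run₁ (l ∷ ls) p q = Plain l p × Run₁ ls (step l p) q ⊎ Marking l p × Run₀ ls (step l p) q

δ-indicates : ∀ (p q : Vec Bool n) → proj₁ (δ p q) Indicates (p ≡ q)
δ-indicates []          []          = holds refl
δ-indicates (false ∷ u) (false ∷ v) = Indicates-⇔ (mk⇔ (cong (false ∷_)) λ { refl → refl }) (δ-indicates u v)
δ-indicates (false ∷ u) (true  ∷ v) = fails λ ()
δ-indicates (true  ∷ u) (false ∷ v) = fails λ ()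
δ-indicates (true  ∷ u) (true  ∷ v) = Indicates-⇔ (mk⇔ (cong (true ∷_)) λ { refl → refl }) (δ-indicates u v)

δ-ε : ∀ (p q : Vec Bool n) → proj₂ (δ p q) ≡ 0
δ-ε []          []          = refl
δ-ε (false ∷ u) (false ∷ v) = δ-ε u v
δ-ε (false ∷ u) (true  ∷ v) = refl
δ-ε (true  ∷ u) (false ∷ v) = refl
δ-ε (true  ∷ u) (true  ∷ v) = δ-ε u v

wordWeight₀ : ∀ (ls : Vec Letter n) p q → proj₁ (wordWeight ls p q) Indicates Run₀ ls p q
wordWeight₀ []       p q = δ-indicates p q
wordWeight₀ (l ∷ ls) p q = Indicates-× (Indicates-bit _) (wordWeight₀ ls (step l p) q)

wordWeight₁ : ∀ (ls : Vec Letter n) p q → proj₂ (wordWeight ls p q) Indicates Run₁ ls p q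
wordWeight₁ []       p q = subst (_Indicates ⊥) (sym (δ-ε p q)) (fails id)
wordWeight₁ (l ∷ ls) p q = Indicates-⊎ (λ (a , _) (b , _) → Plain⇒¬Marking l p a b)
  (Indicates-× (Indicates-bit _) (wordWeight₁ ls (step l p) q))
  (Indicates-× (Indicates-bit _) (wordWeight₀ ls (step l p) q))

Run₀⇔trajectory : ∀ (ls : Vec Letter n) p q →
  Run₀ ls p q ⇔ (trajectory ls p (fromℕ n) ≡ q × ∀ i → Plain (lookup ls i) (trajectory ls p (inject₁ i)))
Run₀⇔trajectory []       p q = mk⇔ (λ eq → eq , λ ()) proj₁
Run₀⇔trajectory (l ∷ ls) p q = mk⇔
  (λ (a , r) → let eq , f = to (Run₀⇔trajectory ls (step l p) q) r in
    eq , λ { zero → a ; (suc i) → f i })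
  (λ (eq , f) → f zero , from (Run₀⇔trajectory ls (step l p) q) (eq , f ∘ suc))

OneMarking : Vec Letter n → (Fin n → State) → Set
OneMarking ls q = ∃[ i ] Marking (lookup ls i) (q i) × ∀ j → j ≢ i → Plain (lookup ls j) (q j)

Run₁⇔trajectory : ∀ (ls : Vec Letter n) p q →
  Run₁ ls p q ⇔ (trajectory ls p (fromℕ n) ≡ q × OneMarking ls (trajectory ls p ∘ inject₁))
Run₁⇔trajectory [] p q = mk⇔ (λ ()) λ ()
Run₁⇔trajectory {suc n} (l ∷ ls) p q = mk⇔ forth back
  where
  forth : Run₁ (l ∷ ls) p q → trajectory ls (step l p) (fromℕ n) ≡ q × OneMarking (l ∷ ls) (trajectory (l ∷ ls) p ∘ inject₁)
  forth (inj₁ (a , r)) = let eq , i , b , f = to (Run₁⇔trajectory ls (step l p) q) r in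
    eq , suc i , b , λ { zero _ → a ; (suc j) j≢i → f j (j≢i ∘ cong suc) }
  forth (inj₂ (b , r)) = let eq , f = to (Run₀⇔trajectory ls (step l p) q) r in
    eq , zero , b , λ { zero 0≢0 → contradiction refl 0≢0 ; (suc j) _ → f j }
  back : trajectory ls (step l p) (fromℕ n) ≡ q × OneMarking (l ∷ ls) (trajectory (l ∷ ls) p ∘ inject₁) → Run₁ (l ∷ ls) p q
  back (eq , zero  , b , f) = inj₂ (b , from (Run₀⇔trajectory ls (step l p) q) (eq , λ j → f (suc j) λ ()))
  back (eq , suc i , b , f) = inj₁ (f zero (λ ()) ,
    from (Run₁⇔trajectory ls (step l p) q) (eq , i , b , λ j j≢i → f (suc j) (j≢i ∘ suc-injective)))

-- Indexed by the rim itself, so that `next` closes the path up; `Run₁⇔ClosedPath` matches this with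
-- a linear reading that starts and ends in the same state.
ClosedPath : Vec Letter n → (Fin n → State) → Set
ClosedPath ls q = (∀ i → q (next i) ≡ step (lookup ls i) (q i)) × OneMarking ls q

OneMarking-cong : ∀ (ls : Vec Letter n) {q q′} → (∀ i → q i ≡ q′ i) → OneMarking ls q → OneMarking ls q′
OneMarking-cong ls eq (i , b , f) = i , subst (Marking (lookup ls i)) (eq i) b ,
  λ j j≢i → subst (Plain (lookup ls j)) (eq j) (f j j≢i)

Run₁⇔ClosedPath : ∀ (ls : Vec Letter (suc n)) p → Run₁ ls p p ⇔ (∃[ q ] q zero ≡ p × ClosedPath ls q)
Run₁⇔ClosedPath {n} ls p = mk⇔ forth back
  where
  forth : Run₁ ls p p → ∃[ q ] q zero ≡ p × ClosedPath ls q
  forth r with to (Run₁⇔trajectory ls p p) r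
  ... | closed , one = trajectory ls p ∘ inject₁ , refl , consistent , one
    where
    consistent : ∀ i → trajectory ls p (inject₁ (next i)) ≡ step (lookup ls i) (trajectory ls p (inject₁ i))
    consistent i = trans (wrap i) (trajectory-step ls p i)
      where
      wrap : ∀ i → trajectory ls p (inject₁ (next i)) ≡ trajectory ls p (suc i)
      wrap i with view i
      ... | ‵fromℕ     = trans (cong (trajectory ls p ∘ inject₁) (next-fromℕ n)) (sym closed)
      ... | ‵inject₁ j = cong (trajectory ls p ∘ inject₁) (next-inject₁ j)
  back : (∃[ q ] q zero ≡ p × ClosedPath ls q) → Run₁ ls p p
  back (q , refl , consistent , one) = from (Run₁⇔trajectory ls p p)
      (trans (sym (agree (fromℕ (suc n)))) (cong q (next-fromℕ n)) ,
       OneMarking-cong ls (λ i → trans (sym (q⁺-inject₁ i)) (agree (inject₁ i))) one)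
    where
    -- Unrolls the cyclic `q` into a linear path whose last state is `q zero` again.
    q⁺ : Fin (suc (suc n)) → State
    q⁺ zero    = q zero
    q⁺ (suc i) = q (next i)
    q⁺-inject₁ : ∀ i → q⁺ (inject₁ i) ≡ q i
    q⁺-inject₁ zero    = refl
    q⁺-inject₁ (suc i) = cong q (next-inject₁ i)
    agree : ∀ i → q⁺ i ≡ trajectory ls p i
    agree = trajectory-unique ls q⁺ λ i → trans (consistent i) (cong (step (lookup ls i)) (sym (q⁺-inject₁ i)))

-- Counting the labellings

T-not : ∀ b → T (not b) ⇔ (¬ T b)
T-not true  = mk⇔ (λ ()) λ f → f tt
T-not false = mk⇔ (λ _ ()) _

valid⇔ : ∀ r s t x y → T (valid (r , s , t) (x ∷ y ∷ [])) ⇔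
  ((T x → ¬ T s) × (T y → ¬ T t) × (¬ T r → T (x ∨ s) ⊎ T (y ∨ t)))
valid⇔ r s t x y = mk⇔
  (λ v → let a , w = to (T-∧ {not (x ∧ s)}) v ; b , c = to (T-∧ {not (y ∧ t)}) w in
    (λ tx ts → to (T-not (x ∧ s)) a (from T-∧ (tx , ts))) ,
    (λ ty tt → to (T-not (y ∧ t)) b (from T-∧ (ty , tt))) ,
    λ ¬r → to T-∨ ([ (λ r → contradiction r ¬r) , id ]′ (to T-∨ c)))
  (λ (a , b , c) → from T-∧
    ( from (T-not (x ∧ s)) (λ p → let u , v = to T-∧ p in a u v)
    , from T-∧ ( from (T-not (y ∧ t)) (λ p → let u , v = to T-∧ p in b u v)
               , rooted r c)))
  where
  rooted : ∀ r → (¬ T r → T (x ∨ s) ⊎ T (y ∨ t)) → T (r ∨ ((x ∨ s) ∨ (y ∨ t)))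
  rooted true  c = tt
  rooted false c = from T-∨ (c id)

marking⇔ : ∀ r s t x y → T (marking (r , s , t) (x ∷ y ∷ [])) ⇔ ((¬ T r) × T (x ∨ s) × T (y ∨ t))
marking⇔ r s t x y = mk⇔
  (λ p → let a , b = to (T-∧ {not r}) p in to (T-not r) a , to T-∧ b)
  (λ (a , b) → from T-∧ (from (T-not r) a , from T-∧ b))

Marking⇔ : ∀ l p → Marking l p ⇔ (T (valid l p) × T (marking l p))
Marking⇔ l p = T-∧

Plain⇔ : ∀ l p → Plain l p ⇔ (T (valid l p) × ¬ T (marking l p))
Plain⇔ l p = mk⇔ (λ u → let a , b = to T-∧ u in a , to (T-not (marking l p)) b)
                 (λ (a , b) → from T-∧ (a , from (T-not (marking l p)) b))

module _ {ρ σ τ : Fin n → Bool} {ls : Vec Letter n} (spelt : ∀ i → lookup ls i ≡ (ρ i , σ i , τ i)) where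

  open Runs ρ using (module Seen; Seen-unique)

  Labelling⇒ClosedPath : ∀ {x y} → Labelling ρ σ τ x y → ClosedPath ls (λ i → x i ∷ y i ∷ [])
  Labelling⇒ClosedPath {x} {y} L = consistent , marked-at , mark , plain
    where
    open Labelling L
    consistent : ∀ i → x (next i) ∷ y (next i) ∷ [] ≡ step (lookup ls i) (x i ∷ y i ∷ [])
    consistent i rewrite spelt i = cong₂ (λ a b → a ∷ b ∷ []) (Seen.carried spokes i) (Seen.carried roots i)
    ok : ∀ i → T (valid (ρ i , σ i , τ i) (x i ∷ y i ∷ []))
    ok i = from (valid⇔ (ρ i) (σ i) (τ i) (x i) (y i)) (Seen.disjoint spokes i , Seen.disjoint roots i , nonempty i)
    marked-at : Fin n
    marked-at = proj₁ marked
    marks : ∀ i → T (marking (ρ i , σ i , τ i) (x i ∷ y i ∷ [])) ⇔ (¬ T (ρ i) × T (x i ∨ σ i) × T (y i ∨ τ i))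
    marks i = marking⇔ (ρ i) (σ i) (τ i) (x i) (y i)
    mark : Marking (lookup ls marked-at) (x marked-at ∷ y marked-at ∷ [])
    mark rewrite spelt marked-at = from (Marking⇔ (ρ marked-at , σ marked-at , τ marked-at) (x marked-at ∷ y marked-at ∷ []))
      (ok marked-at , from (marks marked-at) (proj₁ (proj₂ marked)))
    plain : ∀ j → j ≢ marked-at → Plain (lookup ls j) (x j ∷ y j ∷ [])
    plain j j≢i rewrite spelt j = from (Plain⇔ (ρ j , σ j , τ j) (x j ∷ y j ∷ []))
      (ok j , λ p → j≢i (sym (proj₂ (proj₂ marked) (to (marks j) p))))

  ClosedPath⇒Labelling : ∀ {q} → ClosedPath ls q → Labelling ρ σ τ (λ i → lookup (q i) zero) (λ i → lookup (q i) (suc zero))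
  ClosedPath⇒Labelling {q} (consistent , i , mark , plain) = record
    { spokes   = record { carried  = λ j → cong (λ p → lookup p zero) (step≡ j)
                        ; disjoint = λ j → proj₁ (ok′ j) }
    ; roots    = record { carried  = λ j → cong (λ p → lookup p (suc zero)) (step≡ j)
                        ; disjoint = λ j → proj₁ (proj₂ (ok′ j)) }
    ; nonempty = λ j → proj₂ (proj₂ (ok′ j))
    ; marked   = i , to (marks i) (proj₂ mark′) , λ {j} → unique j
    }
    where
    η : ∀ (p : State) → p ≡ lookup p zero ∷ lookup p (suc zero) ∷ []
    η (x ∷ y ∷ []) = refl
    letter : Fin n → Letter
    letter j = ρ j , σ j , τ j
    state : Fin n → State
    state j = lookup (q j) zero ∷ lookup (q j) (suc zero) ∷ []
    here : (P : Letter → State → Set) → ∀ j → P (lookup ls j) (q j) → P (letter j) (state j)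
    here P j = subst₂ P (spelt j) (η (q j))
    step≡ : ∀ j → q (next j) ≡ step (letter j) (state j)
    step≡ j = trans (consistent j) (cong₂ step (spelt j) (η (q j)))
    marks : ∀ j → T (marking (letter j) (state j)) ⇔
      (¬ T (ρ j) × T (lookup (q j) zero ∨ σ j) × T (lookup (q j) (suc zero) ∨ τ j))
    marks j = marking⇔ (ρ j) (σ j) (τ j) (lookup (q j) zero) (lookup (q j) (suc zero))
    mark′ : T (valid (letter i) (state i)) × T (marking (letter i) (state i))
    mark′ = to (Marking⇔ (letter i) (state i)) (here Marking i mark)
    plain′ : ∀ j → j ≢ i → T (valid (letter j) (state j)) × ¬ T (marking (letter j) (state j))
    plain′ j j≢i = to (Plain⇔ (letter j) (state j)) (here Plain j (plain j j≢i))
    ok : ∀ j → T (valid (letter j) (state j))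
    ok j with j ≟ i
    ... | yes refl = proj₁ mark′
    ... | no j≢i   = proj₁ (plain′ j j≢i)
    ok′ = λ j → to (valid⇔ (ρ j) (σ j) (τ j) (lookup (q j) zero) (lookup (q j) (suc zero))) (ok j)
    unique : ∀ j → ¬ T (ρ j) × T (lookup (q j) zero ∨ σ j) × T (lookup (q j) (suc zero) ∨ τ j) → i ≡ j
    unique j p with j ≟ i
    ... | yes j≡i = sym j≡i
    ... | no j≢i  = contradiction (from (marks j) p) (proj₂ (plain′ j j≢i))

  -- The marking letter sits at a cut, and one cut fixes both families of bits by `Seen-unique`.
  ClosedPath-unique : ∀ {q q′} → ClosedPath ls q → ClosedPath ls q′ → ∀ i → q i ≡ q′ i
  ClosedPath-unique {q} {q′} c c′ i =
    ext (q i) (q′ i) (Seen-unique cut (Labelling.spokes L) (Labelling.spokes L′) i)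
                     (Seen-unique cut (Labelling.roots L) (Labelling.roots L′) i)
    where
    L = ClosedPath⇒Labelling c
    L′ = ClosedPath⇒Labelling c′
    cut = proj₁ (proj₁ (proj₂ (Labelling.marked L)))
    ext : ∀ (p p′ : State) → lookup p zero ≡ lookup p′ zero → lookup p (suc zero) ≡ lookup p′ (suc zero) → p ≡ p′
    ext (x ∷ y ∷ []) (_ ∷ _ ∷ []) refl refl = refl

-- For a fixed edge set at most one start state closes up with a single marking, so each edge set
-- contributes 0 or 1 to the trace coefficient.
closedWeight-indicates : ∀ {ρ σ τ : Fin (suc n) → Bool} {ls : Vec Letter (suc n)} →
  (∀ i → lookup ls i ≡ (ρ i , σ i , τ i)) →
  proj₂ (∑ 2 λ p → wordWeight ls p p) Indicates (∃[ x ] ∃[ y ] Labelling ρ σ τ x y)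
closedWeight-indicates {n} {ρ} {σ} {τ} {ls} spelt = Indicates-⇔ (mk⇔ labelling closedPath)
  (subst (_Indicates ∃ From) (sym (∑-ε 2 loop))
    (Indicates-bitSum 2 {f = proj₂ ∘ loop} {A = From}
      (λ p → Indicates-⇔ (Run₁⇔ClosedPath ls p) (wordWeight₁ ls p p)) start-unique))
  where
  loop : State → 𝔻
  loop p = wordWeight ls p p
  From : State → Set
  From p = ∃[ q ] q zero ≡ p × ClosedPath ls q
  labelling : ∃ From → ∃[ x ] ∃[ y ] Labelling ρ σ τ x y
  labelling (_ , _ , _ , c) = _ , _ , ClosedPath⇒Labelling {ls = ls} spelt c
  closedPath : (∃[ x ] ∃[ y ] Labelling ρ σ τ x y) → ∃ From
  closedPath (_ , _ , L) = _ , _ , refl , Labelling⇒ClosedPath {ls = ls} spelt L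
  start-unique : ∀ {p p′} → From p → From p′ → p ≡ p′
  start-unique (q , refl , c) (q′ , refl , c′) = ClosedPath-unique {ls = ls} spelt c c′ zero

-- From the list of edge sets to the trace

length-filter-map : {A B : Set} {P : Pred B 0ℓ} (P? : Decidable P) (f : A → B) (xs : List A) →
  List.length (List.filter P? (List.map f xs)) ≡ List.length (List.filter (P? ∘ f) xs)
length-filter-map P? f []       = refl
length-filter-map P? f (x ∷ xs) with does (P? (f x))
... | true  = cong suc (length-filter-map P? f xs)
... | false = length-filter-map P? f xs

length-filter-subsets : ∀ n {P : Pred (Subset n) 0ℓ} (P? : Decidable P) →
  List.length (List.filter P? (subsets n)) ≡ bitSum _+_ n (λ S → bit (does (P? S)))
length-filter-subsets zero    P? with does (P? [])
... | true  = refl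
... | false = refl
length-filter-subsets (suc n) P? = begin
  List.length (List.filter P? (outs ++ ins))
    ≡⟨ cong List.length (List.filter-++ P? outs ins) ⟩
  List.length (List.filter P? outs ++ List.filter P? ins)
    ≡⟨ List.length-++ (List.filter P? outs) ⟩
  List.length (List.filter P? outs) + List.length (List.filter P? ins)
    ≡⟨ cong₂ _+_ (trans (length-filter-map P? (false ∷_) (subsets n)) (length-filter-subsets n (P? ∘ (false ∷_))))
                 (trans (length-filter-map P? (true ∷_) (subsets n)) (length-filter-subsets n (P? ∘ (true ∷_)))) ⟩
  bitSum _+_ (suc n) (λ S → bit (does (P? S))) ∎
  where
  open ≡-Reasoning
  outs = List.map (false ∷_) (subsets n)
  ins  = List.map (true ∷_) (subsets n)

bit-does : {A : Set} (a? : Dec A) → bit (does a?) Indicates A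
bit-does (yes a) = holds a
bit-does (no ¬a) = fails ¬a

∑-swap : ∀ n k (f : Vec Bool n → Vec Bool n → Vec Bool k → 𝔻) →
  (bitSum _+_ n λ u → bitSum _+_ n λ v → proj₂ (∑ k (f u v))) ≡ proj₂ (∑ k λ w → ∑ n λ u → ∑ n λ v → f u v w)
∑-swap n k f = begin
  (bitSum _+_ n λ u → bitSum _+_ n λ v → proj₂ (∑ k (f u v)))
    ≡⟨ bitSum-cong _+_ n (λ u → sym (∑-ε n λ v → ∑ k (f u v))) ⟩
  (bitSum _+_ n λ u → proj₂ (∑ n λ v → ∑ k (f u v)))
    ≡⟨ sym (∑-ε n λ u → ∑ n λ v → ∑ k (f u v)) ⟩
  proj₂ (∑ n λ u → ∑ n λ v → ∑ k (f u v))
    ≡⟨ cong proj₂ (∑-cong n λ u → ∑-comm n k (f u)) ⟩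
  proj₂ (∑ n λ u → ∑ k λ w → ∑ n λ v → f u v w)
    ≡⟨ cong proj₂ (∑-comm n k λ u w → ∑ n λ v → f u v w) ⟩
  proj₂ (∑ k λ w → ∑ n λ u → ∑ n λ v → f u v w) ∎
  where open ≡-Reasoning

count-closed : ∀ {n} {P : Pred (Subset (n + n)) 0ℓ} (P? : Decidable P) (ts : Vec Bool n) →
  (∀ rs ss → proj₂ (∑ 2 λ p → wordWeight (letters ts rs ss) p p) Indicates P (rs Vec.++ ss)) →
  List.length (List.filter P? (subsets (n + n))) ≡ proj₂ (trace (toList ts))
count-closed {n} P? ts indicates = begin
  List.length (List.filter P? (subsets (n + n)))
    ≡⟨ length-filter-subsets (n + n) P? ⟩
  bitSum _+_ (n + n) (λ S → bit (does (P? S)))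
    ≡⟨ bitSum-++ _+_ n n (λ S → bit (does (P? S))) ⟩
  (bitSum _+_ n λ rs → bitSum _+_ n λ ss → bit (does (P? (rs Vec.++ ss))))
    ≡⟨ bitSum-cong _+_ n (λ rs → bitSum-cong _+_ n λ ss →
         Indicates-unique (bit-does (P? (rs Vec.++ ss))) (indicates rs ss)) ⟩
  (bitSum _+_ n λ rs → bitSum _+_ n λ ss → proj₂ (∑ 2 λ p → wordWeight (letters ts rs ss) p p))
    ≡⟨ ∑-swap n 2 (λ rs ss p → wordWeight (letters ts rs ss) p p) ⟩
  proj₂ (∑ 2 λ p → ∑ n λ rs → ∑ n λ ss → wordWeight (letters ts rs ss) p p)
    ≡⟨ cong proj₂ (∑-cong 2 {f = λ p → ∑ n λ rs → ∑ n λ ss → wordWeight (letters ts rs ss) p p}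
                            {g = λ p → transfer (toList ts) p p} (λ p → ∑-wordWeight ts p p)) ⟩
  proj₂ (trace (toList ts)) ∎
  where open ≡-Reasoning

𝓕-trace : ∀ {N} (3≤N : 3 ≤ N) (ts : Vec Bool N) → 𝓕 (wheel N 3≤N) (false ∷ ts) ≡ proj₂ (trace (toList ts))
𝓕-trace {suc n} 3≤N ts = count-closed (λ S → isRootedForest? (wheel (suc n) 3≤N) S (false ∷ ts)) ts indicates
  where
  indicates : ∀ rs ss → proj₂ (∑ 2 λ p → wordWeight (letters ts rs ss) p p)
    Indicates IsRootedForest (wheel (suc n) 3≤N) (rs Vec.++ ss) (false ∷ ts)
  indicates rs ss = Indicates-⇔ (mk⇔ (from equiv) (to equiv)) (closedWeight-indicates {ls = letters ts rs ss} spelt)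
    where
    S = rs Vec.++ ss
    equiv = WheelForests.forest⇔labelling 3≤N S (false ∷ ts) λ ()
    spelt : ∀ i → lookup (letters ts rs ss) i ≡ (rimBits S i , spokeBits S i , rootBits (false ∷ ts) i)
    spelt i rewrite lookup-++ˡ rs ss i | lookup-++ʳ rs ss i = lookup-letters ts rs ss i

-- Fibonacci and Lucas numbers as transfer coefficients

pattern s₀₀ = false ∷ false ∷ []
pattern s₀₁ = false ∷ true  ∷ []
pattern s₁₀ = true  ∷ false ∷ []
pattern s₁₁ = true  ∷ true  ∷ []

-- fib₂ n = F₂ₙ, fib₂⁻ n = F₂ₙ₋₁ - 1 and luc₂ n = L₂ₙ - 2.
fib₂ fib₂⁻ luc₂ : ℕ → ℕ
fib₂ zero     = 0
fib₂ (suc n)  = fib₂ n + suc (fib₂⁻ n) + fib₂ n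
fib₂⁻ zero    = 0
fib₂⁻ (suc n) = fib₂ n + fib₂⁻ n
luc₂ n = fib₂ n + fib₂⁻ n + fib₂⁻ n

fib-double : ∀ n → fib (2 * n) ≡ fib₂ n × fib (suc (2 * n)) ≡ fib₂ n + suc (fib₂⁻ n)
fib-double zero    = refl , refl
fib-double (suc n) with fib-double n
... | e , o rewrite ℕ.+-suc n (n + 0) | e | o = refl ,
  solve 2 (λ e g → (e :+ (con 1 :+ g) :+ e) :+ (e :+ (con 1 :+ g)) := (e :+ (con 1 :+ g) :+ e) :+ (con 1 :+ (e :+ g)))
    refl (fib₂ n) (fib₂⁻ n)

lucas-double : ∀ n → lucas (2 * n) ≡ 2 + luc₂ n × lucas (suc (2 * n)) ≡ suc (fib₂ n + fib₂ n + fib₂ n + fib₂⁻ n)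
lucas-double zero    = refl , refl
lucas-double (suc n) with lucas-double n
... | e , o rewrite ℕ.+-suc n (n + 0) | e | o =
  solve 2 (λ e g → (con 1 :+ (e :+ e :+ e :+ g)) :+ (con 2 :+ (e :+ g :+ g))
                := con 2 :+ ((e :+ (con 1 :+ g) :+ e) :+ (e :+ g) :+ (e :+ g))) refl (fib₂ n) (fib₂⁻ n) ,
  solve 2 (λ e g → (con 1 :+ (e :+ e :+ e :+ g)) :+ (con 2 :+ (e :+ g :+ g)) :+ (con 1 :+ (e :+ e :+ e :+ g))
                := con 1 :+ ((e :+ (con 1 :+ g) :+ e) :+ (e :+ (con 1 :+ g) :+ e) :+ (e :+ (con 1 :+ g) :+ e) :+ (e :+ g)))
    refl (fib₂ n) (fib₂⁻ n)

falses : ℕ → List Bool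
falses n = replicate n false

-- Only target states without a root are recorded, since a root read next sends the others to 0. The
-- number `q` gets no closed form: in products of blocks it meets a factor 0 or passes into another
-- `q`.
record FalsesTransfer (n : ℕ) : Set where
  field
    q     : ℕ
    t₀₀₀₀ : transfer (falses n) s₀₀ s₀₀ ≡ (fib₂ n + suc (fib₂⁻ n) , 0)
    t₀₀₁₀ : transfer (falses n) s₀₀ s₁₀ ≡ (fib₂ n , 0)
    t₁₀₀₀ : transfer (falses n) s₁₀ s₀₀ ≡ (fib₂ n , 0)
    t₁₀₁₀ : transfer (falses n) s₁₀ s₁₀ ≡ (suc (fib₂⁻ n) , 0)
    t₀₁₀₀ : transfer (falses n) s₀₁ s₀₀ ≡ (fib₂ n , fib₂ n + fib₂⁻ n)
    t₀₁₁₀ : transfer (falses n) s₀₁ s₁₀ ≡ (fib₂⁻ n , q)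
    t₁₁₀₀ : transfer (falses n) s₁₁ s₀₀ ≡ (0 , fib₂ n)
    t₁₁₁₀ : transfer (falses n) s₁₁ s₁₀ ≡ (0 , fib₂⁻ n)

falses-transfer : ∀ n → FalsesTransfer n
falses-transfer zero = record
  { q = 0 ; t₀₀₀₀ = refl ; t₀₀₁₀ = refl ; t₁₀₀₀ = refl ; t₁₀₁₀ = refl
  ; t₀₁₀₀ = refl ; t₀₁₁₀ = refl ; t₁₁₀₀ = refl ; t₁₁₁₀ = refl }
falses-transfer (suc n) = record
  { q     = q + fib₂⁻ n + fib₂ n
  ; t₀₀₀₀ = trans (cong₂ from₀₀ t₀₀₀₀ t₁₀₀₀) (cong₂ _,_
      (solve 2 (λ e g → (con 0 :+ con 1 :* (e :+ (con 1 :+ g))) :+ (con 1 :* (e :+ (con 1 :+ g)) :+ con 1 :* e)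
         := (e :+ (con 1 :+ g) :+ e) :+ (con 1 :+ (e :+ g))) refl e g) refl)
  ; t₀₀₁₀ = trans (cong₂ from₀₀ t₀₀₁₀ t₁₀₁₀) (cong₂ _,_
      (solve 2 (λ e g → (con 0 :+ con 1 :* e) :+ (con 1 :* e :+ con 1 :* (con 1 :+ g))
         := e :+ (con 1 :+ g) :+ e) refl e g) refl)
  ; t₁₀₀₀ = trans (cong₂ from₁₀ t₀₀₀₀ t₁₀₀₀) (cong₂ _,_
      (solve 2 (λ e g → con 1 :* (e :+ (con 1 :+ g)) :+ con 0 :+ (con 1 :* e :+ con 0)
         := e :+ (con 1 :+ g) :+ e) refl e g) refl)
  ; t₁₀₁₀ = trans (cong₂ from₁₀ t₀₀₁₀ t₁₀₁₀) (cong₂ _,_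
      (solve 2 (λ e g → con 1 :* e :+ con 0 :+ (con 1 :* (con 1 :+ g) :+ con 0)
         := con 1 :+ (e :+ g)) refl e g) refl)
  ; t₀₁₀₀ = trans (cong₃ from₀₁ t₀₀₀₀ t₀₁₀₀ t₁₁₀₀) (cong₂ _,_
      (solve 2 (λ e g → con 1 :* (e :+ (con 1 :+ g)) :+ con 0 :+ (con 1 :* e :+ con 1 :* con 0)
         := e :+ (con 1 :+ g) :+ e) refl e g)
      (solve 2 (λ e g → con 1 :* con 0 :+ con 0 :+ (con 0 :+ con 1 :* (e :+ (con 1 :+ g)))
           :+ (con 1 :* (e :+ g) :+ con 0 :+ (con 1 :* e :+ con 0))
         := (e :+ (con 1 :+ g) :+ e) :+ (e :+ g)) refl e g))
  ; t₀₁₁₀ = trans (cong₃ from₀₁ t₀₀₁₀ t₀₁₁₀ t₁₁₁₀) (cong₂ _,_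
      (solve 2 (λ e g → con 1 :* e :+ con 0 :+ (con 1 :* g :+ con 1 :* con 0)
         := e :+ g) refl e g)
      (solve 3 (λ e g q → con 1 :* con 0 :+ con 0 :+ (con 0 :+ con 1 :* e)
           :+ (con 1 :* q :+ con 0 :+ (con 1 :* g :+ con 0))
         := q :+ g :+ e) refl e g q))
  ; t₁₁₀₀ = trans (cong₂ from₁₁ t₀₀₀₀ t₁₁₀₀) (cong₂ _,_ refl
      (solve 2 (λ e g → con 1 :* (e :+ (con 1 :+ g)) :+ con 0 :+ (con 1 :* e :+ con 0 :+ con 0)
         := e :+ (con 1 :+ g) :+ e) refl e g))
  ; t₁₁₁₀ = trans (cong₂ from₁₁ t₀₀₁₀ t₁₁₁₀) (cong₂ _,_ refl
      (solve 2 (λ e g → con 1 :* e :+ con 0 :+ (con 1 :* g :+ con 0 :+ con 0)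
         := e :+ g) refl e g))
  }
  where
  open FalsesTransfer (falses-transfer n)
  e = fib₂ n
  g = fib₂⁻ n
  -- Rows of the matrix of one non-root. The four summands end the path without and with a spoke,
  -- then continue it without and with a spoke.
  from₀₀ from₁₀ from₁₁ : 𝔻 → 𝔻 → 𝔻
  from₀₀ a b = (0𝔻 ⊕ 1𝔻 ⊗ a) ⊕ (1𝔻 ⊗ a ⊕ 1𝔻 ⊗ b)
  from₁₀ a b = (1𝔻 ⊗ a ⊕ 0𝔻) ⊕ (1𝔻 ⊗ b ⊕ 0𝔻)
  from₁₁ a b = ((0 , 1) ⊗ a ⊕ 0𝔻) ⊕ (1𝔻 ⊗ b ⊕ 0𝔻)
  from₀₁ : 𝔻 → 𝔻 → 𝔻 → 𝔻
  from₀₁ a b c = (1𝔻 ⊗ a ⊕ (0 , 1) ⊗ a) ⊕ (1𝔻 ⊗ b ⊕ 1𝔻 ⊗ c)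
  cong₃ : ∀ (f : 𝔻 → 𝔻 → 𝔻 → 𝔻) {a a′ b b′ c c′} → a ≡ a′ → b ≡ b′ → c ≡ c′ → f a b c ≡ f a′ b′ c′
  cong₃ f refl refl refl = refl

block : ℕ → List Bool
block d = true ∷ falses (d ∸ 1)

-- The rows of the states that have met a root vanish because the word begins with a root, so a
-- product passes only through `s₀₀` and `s₁₀`.
record BlockTransfer (ts : List Bool) (f g p : ℕ) : Set where
  field
    q     : ℕ
    t₀₀₀₀ : transfer ts s₀₀ s₀₀ ≡ (f , p)
    t₀₀₁₀ : transfer ts s₀₀ s₁₀ ≡ (g , q)
    t₁₀₀₀ : transfer ts s₁₀ s₀₀ ≡ (0 , f)
    t₁₀₁₀ : transfer ts s₁₀ s₁₀ ≡ (0 , g)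
    t₀₁   : ∀ u → transfer ts s₀₁ u ≡ 0𝔻
    t₁₁   : ∀ u → transfer ts s₁₁ u ≡ 0𝔻

-- A root acts on a vertex that starts a new rim path as a non-root does on a
-- path with a root on it, whence the reduction to a run of n + 1 non-roots.
block-transfer : ∀ n → BlockTransfer (block (suc n)) (fib₂ (suc n)) (fib₂⁻ (suc n)) (fib₂ (suc n) + fib₂⁻ (suc n))
block-transfer n = record
  { q = q ; t₀₀₀₀ = t₀₁₀₀ ; t₀₀₁₀ = t₀₁₁₀ ; t₁₀₀₀ = t₁₁₀₀ ; t₁₀₁₀ = t₁₁₁₀
  ; t₀₁ = λ _ → refl ; t₁₁ = λ _ → refl }
  where open FalsesTransfer (falses-transfer (suc n))

module _ {ts us f g p f′ g′ p′} (A : BlockTransfer ts f g p) (B : BlockTransfer us f′ g′ p′) where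
  private
    module A = BlockTransfer A
    module B = BlockTransfer B

  transfer-++-two : ∀ s v → transfer (ts ++ us) s v ≡
    transfer ts s s₀₀ ⊗ transfer us s₀₀ v ⊕ transfer ts s s₁₀ ⊗ transfer us s₁₀ v
  transfer-++-two s v = trans (transfer-++ ts us s v) (cong₂ _⊕_ (vanish s₀₀ s₀₁ (B.t₀₁ v)) (vanish s₁₀ s₁₁ (B.t₁₁ v)))
    where
    vanish : ∀ w z → transfer us z v ≡ 0𝔻 →
      transfer ts s w ⊗ transfer us w v ⊕ transfer ts s z ⊗ transfer us z v ≡ transfer ts s w ⊗ transfer us w v
    vanish w z eq = trans (cong (transfer ts s w ⊗ transfer us w v ⊕_)
      (trans (cong (transfer ts s z ⊗_) eq) (⊗-comm (transfer ts s z) 0𝔻))) (⊕-identityʳ _)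

  -- The new trace coefficient is f p′ + (p + g) f′ + f g′ = (p + g) f′ + f (p′ + g′), which is the
  -- Leibniz rule for p + g.
  ++-transfer : BlockTransfer (ts ++ us) (f * f′) (f * g′) (f * p′ + (p + g) * f′)
  ++-transfer = record
    { q     = f * B.q + (p + g) * g′
    ; t₀₀₀₀ = trans (transfer-++-two s₀₀ s₀₀) (trans (entry A.t₀₀₀₀ B.t₀₀₀₀ A.t₀₀₁₀ B.t₁₀₀₀) (cong₂ _,_
        (solve 3 (λ f f′ g → f :* f′ :+ g :* con 0 := f :* f′) refl f f′ g)
        (solve 6 (λ f p′ p f′ g q → (f :* p′ :+ p :* f′) :+ (g :* f′ :+ q :* con 0) := f :* p′ :+ (p :+ g) :* f′)
          refl f p′ p f′ g A.q)))
    ; t₀₀₁₀ = trans (transfer-++-two s₀₀ s₁₀) (trans (entry A.t₀₀₀₀ B.t₀₀₁₀ A.t₀₀₁₀ B.t₁₀₁₀) (cong₂ _,_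
        (solve 3 (λ f f′ g → f :* f′ :+ g :* con 0 := f :* f′) refl f g′ g)
        (solve 6 (λ f p′ p f′ g q → (f :* p′ :+ p :* f′) :+ (g :* f′ :+ q :* con 0) := f :* p′ :+ (p :+ g) :* f′)
          refl f B.q p g′ g A.q)))
    ; t₁₀₀₀ = trans (transfer-++-two s₁₀ s₀₀) (trans (entry A.t₁₀₀₀ B.t₀₀₀₀ A.t₁₀₁₀ B.t₁₀₀₀) (cong₂ _,_ refl
        (solve 3 (λ f f′ g → (con 0 :+ f :* f′) :+ (con 0 :+ g :* con 0) := f :* f′) refl f f′ g)))
    ; t₁₀₁₀ = trans (transfer-++-two s₁₀ s₁₀) (trans (entry A.t₁₀₀₀ B.t₀₀₁₀ A.t₁₀₁₀ B.t₁₀₁₀) (cong₂ _,_ refl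
        (solve 3 (λ f f′ g → (con 0 :+ f :* f′) :+ (con 0 :+ g :* con 0) := f :* f′) refl f g′ g)))
    ; t₀₁   = λ v → trans (transfer-++-two s₀₁ v) (entry (A.t₀₁ s₀₀) refl (A.t₀₁ s₁₀) refl)
    ; t₁₁   = λ v → trans (transfer-++-two s₁₁ v) (entry (A.t₁₁ s₀₀) refl (A.t₁₁ s₁₀) refl)
    }
    where
    entry : ∀ {a a′ b b′ c c′ d d′} → a ≡ a′ → b ≡ b′ → c ≡ c′ → d ≡ d′ → a ⊗ b ⊕ c ⊗ d ≡ a′ ⊗ b′ ⊕ c′ ⊗ d′
    entry refl refl refl refl = refl

trace-ε : ∀ {ts f g p} → BlockTransfer ts f g p → proj₂ (trace ts) ≡ p + g
trace-ε {ts} {f} {g} {p} B = begin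
  proj₂ ((transfer ts s₀₀ s₀₀ ⊕ transfer ts s₀₁ s₀₁) ⊕ (transfer ts s₁₀ s₁₀ ⊕ transfer ts s₁₁ s₁₁))
    ≡⟨ cong proj₂ (cong₂ _⊕_ (cong₂ _⊕_ t₀₀₀₀ (t₀₁ s₀₁)) (cong₂ _⊕_ t₁₀₁₀ (t₁₁ s₁₁))) ⟩
  (p + 0) + (g + 0)
    ≡⟨ cong₂ _+_ (ℕ.+-identityʳ p) (ℕ.+-identityʳ g) ⟩
  p + g ∎
  where
  open ≡-Reasoning
  open BlockTransfer B

word : (Fin r → ℕ) → List Bool
word {zero}  d = []
word {suc r} d = block (d zero) ++ word (d ∘ suc)

-- The sum of each `l i` times the product of the other values of `f`, in the recursive form that
-- the Leibniz rule produces.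
∑∏ : (l f : Fin r → ℕ) → ℕ
∑∏ {zero}  l f = 0
∑∏ {suc r} l f = l zero * ∏ (f ∘ suc) + f zero * ∑∏ (l ∘ suc) (f ∘ suc)

word-transfer : (d : Fin (suc r) → ℕ) → (∀ i → 0 < d i) →
  ∃[ g ] ∃[ p ] BlockTransfer (word d) (∏ (fib₂ ∘ d)) g p × p + g ≡ ∑∏ (luc₂ ∘ d) (fib₂ ∘ d)
word-transfer {zero} d pos with d zero | pos zero
-- The word of a single block carries a trailing `[]`, and its product a trailing factor 1.
... | suc n | _ = _ , _ , subst₂ (λ ts f → BlockTransfer ts f (fib₂⁻ (suc n)) (fib₂ (suc n) + fib₂⁻ (suc n)))
                                 (sym (List.++-identityʳ _)) (sym (ℕ.*-identityʳ _)) (block-transfer n) ,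
  solve 2 (λ e g → e :+ g :+ g := (e :+ g :+ g) :* con 1 :+ e :* con 0) refl (fib₂ (suc n)) (fib₂⁻ (suc n))
word-transfer {suc r} d pos with d zero | pos zero | word-transfer (d ∘ suc) (pos ∘ suc)
... | suc n | _ | g′ , p′ , B , eq = _ , _ , ++-transfer (block-transfer n) B , trans
  (solve 5 (λ e g f′ p′ g′ → e :* p′ :+ (e :+ g :+ g) :* f′ :+ e :* g′ := (e :+ g :+ g) :* f′ :+ e :* (p′ :+ g′))
    refl (fib₂ (suc n)) (fib₂⁻ (suc n)) (∏ (fib₂ ∘ d ∘ suc)) p′ g′)
  (cong (λ t → luc₂ (suc n) * ∏ (fib₂ ∘ d ∘ suc) + fib₂ (suc n) * t) eq)

trace-word : (d : Fin (suc r) → ℕ) → (∀ i → 0 < d i) → proj₂ (trace (word d)) ≡ ∑∏ (luc₂ ∘ d) (fib₂ ∘ d)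
trace-word d pos with word-transfer d pos
... | _ , _ , B , eq = trans (trace-ε B) eq

-- The word of the root set

rimSet : (Fin k → Fin n) → Subset n
rimSet a = ⋃ (List.tabulate λ i → ⁅ a i ⁆)

rimVertices≡ : (a : Fin k → Fin n) → rimVertices a ≡ false ∷ rimSet a
rimVertices≡ {zero}  a = refl
rimVertices≡ {suc k} a = cong (⁅ suc (a zero) ⁆ ∪_) (rimVertices≡ (a ∘ suc))

∈-rimSet : (a : Fin k → Fin n) → ∀ {i} → i ∈ rimSet a ⇔ (∃[ j ] a j ≡ i)
∈-rimSet {zero}  a = mk⇔ (λ i∈⊥ → contradiction i∈⊥ ∉⊥) λ ()
∈-rimSet {suc k} a {i} = mk⇔ into back
  where
  into : i ∈ rimSet a → ∃[ j ] a j ≡ i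
  into p with x∈p∪q⁻ ⁅ a zero ⁆ (rimSet (a ∘ suc)) p
  ... | inj₁ q = zero , sym (x∈⁅y⁆⇒x≡y _ q)
  ... | inj₂ q = let j , eq = to (∈-rimSet (a ∘ suc)) q in suc j , eq
  back : (∃[ j ] a j ≡ i) → i ∈ rimSet a
  back (zero  , refl) = x∈p∪q⁺ (inj₁ (x∈⁅x⁆ _))
  back (suc j , eq)   = x∈p∪q⁺ (inj₂ (from (∈-rimSet (a ∘ suc)) (j , eq)))

-- Recursive, to follow `word`, with `w` the position at which the last block stops. Taking for `w`
-- the first position plus the rim length gives `gap`.
gaps : (Fin (suc r) → ℕ) → ℕ → Fin (suc r) → ℕ
gaps {zero}  α w _       = w ∸ α zero
gaps {suc r} α w zero    = α (suc zero) ∸ α zero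
gaps {suc r} α w (suc i) = gaps (α ∘ suc) w i

gaps-inner : ∀ (α : Fin (suc r) → ℕ) w i (i<r : suc (toℕ i) < suc r) → gaps α w i ≡ α (fromℕ< i<r) ∸ α i
gaps-inner {zero}  α w zero    (s≤s ())
gaps-inner {suc r} α w zero    (s≤s (s≤s z≤n)) = refl
gaps-inner {suc r} α w (suc i) (s≤s i<r) = gaps-inner (α ∘ suc) w i i<r

gaps-last : ∀ (α : Fin (suc r) → ℕ) w i → ¬ suc (toℕ i) < suc r → gaps α w i ≡ w ∸ α i
gaps-last {zero}  α w zero    i≮r = refl
gaps-last {suc r} α w zero    i≮r = contradiction (s≤s (s≤s z≤n)) i≮r
gaps-last {suc r} α w (suc i) i≮r = gaps-last (α ∘ suc) w i (i≮r ∘ s≤s)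

gap≡gaps : ∀ (a : Fin (suc r) → Fin n) i → gap a i ≡ gaps (toℕ ∘ a) (toℕ (a zero) + n) i
gap≡gaps {r} a i with suc (toℕ i) ℕ.<? suc r
... | yes i<r = sym (gaps-inner (toℕ ∘ a) _ i i<r)
... | no  i≮r = sym (gaps-last (toℕ ∘ a) _ i i≮r)

gaps-pred : ∀ (α : Fin (suc r) → ℕ) w → (∀ i → 0 < α i) → ∀ i → gaps (pred ∘ α) w i ≡ gaps α (suc w) i
gaps-pred {zero}  α w pos i       = pred-∸ (pos zero)
  where
  pred-∸ : ∀ {m} → 0 < m → w ∸ pred m ≡ suc w ∸ m
  pred-∸ (s≤s _) = refl
gaps-pred {suc r} α w pos zero    = pred-∸-pred (pos zero) (pos (suc zero))
  where
  pred-∸-pred : ∀ {l m} → 0 < l → 0 < m → pred m ∸ pred l ≡ m ∸ l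
  pred-∸-pred (s≤s _) (s≤s _) = refl
gaps-pred {suc r} α w pos (suc i) = gaps-pred (α ∘ suc) w (pos ∘ suc) i

word-cong : {c d : Fin r → ℕ} → (∀ i → c i ≡ d i) → word c ≡ word d
word-cong {zero}  eq = refl
word-cong {suc r} eq = cong₂ (λ d ts → block d ++ ts) (eq zero) (word-cong (eq ∘ suc))

Increasing : (Fin r → ℕ) → Set
Increasing α = ∀ {i j} → i Fin.< j → α i < α j

SpelledBy : Vec Bool n → (Fin r → ℕ) → Set
SpelledBy ts α = ∀ i → T (lookup ts i) ⇔ (∃[ j ] α j ≡ toℕ i)

pred-increasing : (α : Fin r → ℕ) → (∀ i → 0 < α i) → Increasing α → Increasing (pred ∘ α)
pred-increasing α pos α↑ {i} {j} i<j = pred-< (pos i) (α↑ i<j)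
  where
  pred-< : ∀ {l m} → 0 < l → l < m → pred l < pred m
  pred-< (s≤s _) (s≤s l<m) = l<m

spelledBy-tail : ∀ (ts : Vec Bool n) (α : Fin r → ℕ) → (∀ i → 0 < α i) →
  (∀ i → T (lookup ts i) ⇔ (∃[ j ] α j ≡ suc (toℕ i))) → SpelledBy ts (pred ∘ α)
spelledBy-tail ts α pos spelt i = ⇔-trans (spelt i) (mk⇔
  (λ (j , eq) → j , cong pred eq)
  (λ (j , eq) → j , trans (sym (ℕ.suc-pred (α j) ⦃ ℕ.>-nonZero (pos j) ⦄)) (cong suc eq)))

no-roots : (ts : Vec Bool n) → (∀ i → ¬ T (lookup ts i)) → toList ts ≡ falses n
no-roots []           f = refl
no-roots (true  ∷ ts) f = contradiction tt (f zero)
no-roots (false ∷ ts) f = cong (false ∷_) (no-roots ts (f ∘ suc))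

falses-++ : ∀ m n → falses m ++ falses n ≡ falses (m + n)
falses-++ zero    n = refl
falses-++ (suc m) n = cong (false ∷_) (falses-++ m n)

-- The `z` extra non-roots lengthen the last block. For `z = α zero` they stand for the non-roots
-- before the first root, moved to the end, and the last gap becomes the cyclic one.
spelled-word : ∀ (ts : Vec Bool n) z (α : Fin (suc r) → ℕ) → Increasing α → (∀ i → α i < n) → SpelledBy ts α →
  toList ts ++ falses z ≡ falses (α zero) ++ word (gaps α (n + z))
spelled-word []  z α α↑ α<n spelt with () ← α<n zero
spelled-word {suc n} {r} (t ∷ ts) z α α↑ α<n spelt with α zero in α₀ | t | spelt zero
... | suc m | true  | sp = let j , eq = to sp tt in contradiction eq (ℕ.>⇒≢ (pos j))
  where
  pos : ∀ i → 0 < α i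
  pos zero    = subst (0 <_) (sym α₀) (s≤s z≤n)
  pos (suc i) = ℕ.≤-<-trans z≤n (α↑ {zero} (s≤s z≤n))
... | suc m | false | _ = cong (false ∷_) (begin
  toList ts ++ falses z
    ≡⟨ spelled-word ts z (pred ∘ α) (pred-increasing α pos α↑)
         (λ i → s≤s⁻¹ (subst (_< suc n) (sym (ℕ.suc-pred (α i) ⦃ ℕ.>-nonZero (pos i) ⦄)) (α<n i)))
         (spelledBy-tail ts α pos (spelt ∘ suc)) ⟩
  falses (pred (α zero)) ++ word (gaps (pred ∘ α) (n + z))
    ≡⟨ cong₂ (λ l ws → falses l ++ ws) (cong pred α₀) (word-cong (gaps-pred α (n + z) pos)) ⟩
  falses m ++ word (gaps α (suc n + z)) ∎)
  where
  open ≡-Reasoning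
  pos : ∀ i → 0 < α i
  pos zero    = subst (0 <_) (sym α₀) (s≤s z≤n)
  pos (suc i) = ℕ.≤-<-trans z≤n (α↑ {zero} (s≤s z≤n))
... | zero | false | sp = ⊥-elim (from sp (zero , α₀))
spelled-word {suc n} {zero} (t ∷ ts) z α α↑ α<n spelt | zero | true | _ rewrite α₀ = cong (true ∷_) (begin
  toList ts ++ falses z
    ≡⟨ cong (_++ falses z) (no-roots ts λ i tr → case-suc (to (spelt (suc i)) tr)) ⟩
  falses n ++ falses z
    ≡⟨ falses-++ n z ⟩
  falses (n + z)
    ≡⟨ sym (List.++-identityʳ _) ⟩
  falses (n + z) ++ [] ∎)
  where
  open ≡-Reasoning
  case-suc : ∀ {i : Fin n} → ¬ (∃[ j ] α j ≡ suc (toℕ i))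
  case-suc (zero , eq) with () ← trans (sym α₀) eq
spelled-word {suc n} {suc r} (t ∷ ts) z α α↑ α<n spelt | zero | true | _ = cong (true ∷_) (begin
  toList ts ++ falses z
    ≡⟨ spelled-word ts z (pred ∘ α ∘ suc) (pred-increasing (α ∘ suc) pos (α↑ ∘ s≤s))
         (λ i → s≤s⁻¹ (subst (_< suc n) (sym (ℕ.suc-pred (α (suc i)) ⦃ ℕ.>-nonZero (pos i) ⦄)) (α<n (suc i))))
         (spelledBy-tail ts (α ∘ suc) pos (λ i → ⇔-trans (spelt (suc i)) (skip i))) ⟩
  falses (pred (α (suc zero))) ++ word (gaps (pred ∘ α ∘ suc) (n + z))
    -- The root takes one place of its block, so one less than the gap remains for non-roots;
    -- `α zero` is 0 here.
    ≡⟨ cong₂ (λ l ws → falses l ++ ws) (cong (λ m → α (suc zero) ∸ m ∸ 1) (sym α₀)) (word-cong (gaps-pred (α ∘ suc) (n + z) pos)) ⟩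
  falses (α (suc zero) ∸ α zero ∸ 1) ++ word (gaps (α ∘ suc) (suc n + z)) ∎)
  where
  open ≡-Reasoning
  pos : ∀ i → 0 < α (suc i)
  pos i = ℕ.≤-<-trans z≤n (α↑ {zero} (s≤s z≤n))
  skip : ∀ i → (∃[ j ] α j ≡ suc (toℕ i)) ⇔ (∃[ j ] α (suc j) ≡ suc (toℕ i))
  skip i = mk⇔ (λ { (zero , eq) → contradiction (trans (sym α₀) eq) λ () ; (suc j , eq) → j , eq }) λ (j , eq) → suc j , eq

trace-rimSet : (a : Fin (suc r) → Fin n) → a Preserves Fin._<_ ⟶ Fin._<_ → trace (toList (rimSet a)) ≡ trace (word (gap a))
trace-rimSet {r} {n} a a↑ = begin
  trace (toList (rimSet a))
    ≡⟨ cong trace (trans (sym (List.++-identityʳ _)) (spelled 0)) ⟩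
  trace (falses (α zero) ++ word (gaps α (n + 0)))
    ≡⟨ trace-rotate (falses (α zero)) (word (gaps α (n + 0))) ⟩
  trace (word (gaps α (n + 0)) ++ falses (α zero))
    ≡⟨ cong trace (List.++-cancelˡ (falses (α zero)) _ _ shifted) ⟩
  trace (word (gaps α (n + α zero)))
    ≡⟨ cong trace (word-cong λ i → trans (cong (λ w → gaps α w i) (ℕ.+-comm n (α zero))) (sym (gap≡gaps a i))) ⟩
  trace (word (gap a)) ∎
  where
  open ≡-Reasoning
  α = toℕ ∘ a
  spelt : SpelledBy (rimSet a) α
  spelt i = mk⇔ (λ t → let j , eq = to (∈-rimSet a) (from T-lookup t) in j , cong toℕ eq)
                (λ (j , eq) → to T-lookup (from (∈-rimSet a) (j , toℕ-injective eq)))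
  spelled : ∀ z → toList (rimSet a) ++ falses z ≡ falses (α zero) ++ word (gaps α (n + z))
  spelled z = spelled-word (rimSet a) z α a↑ (toℕ<n ∘ a) spelt
  -- Both sides spell the rim followed by `α zero` non-roots: the left pads the reading with
  -- `z = 0`, the right takes `z = α zero`. The common prefix is cancelled afterwards.
  shifted : falses (α zero) ++ word (gaps α (n + 0)) ++ falses (α zero) ≡ falses (α zero) ++ word (gaps α (n + α zero))
  shifted = begin
    falses (α zero) ++ word (gaps α (n + 0)) ++ falses (α zero)
      ≡⟨ sym (List.++-assoc (falses (α zero)) _ _) ⟩
    (falses (α zero) ++ word (gaps α (n + 0))) ++ falses (α zero)
      ≡⟨ cong (_++ falses (α zero)) (trans (sym (spelled 0)) (List.++-identityʳ _)) ⟩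
    toList (rimSet a) ++ falses (α zero)
      ≡⟨ spelled (α zero) ⟩
    falses (α zero) ++ word (gaps α (n + α zero)) ∎

-- Integer and rational forms of the sum

-- One term is a case of its own because `∏-except (suc i) f` unfolds to `f zero` times the
-- remaining product only when at least two factors are known to exist.
∑∏≡∑ℤ : (l f : Fin r → ℕ) → + ∑∏ l f ≡ ∑ℤ (λ i → + l i ℤ.* + ∏-except i f)
∑∏≡∑ℤ {zero}        l f = refl
∑∏≡∑ℤ {suc zero}    l f = begin
  + (l zero * 1 + f zero * 0)
    ≡⟨ cong (λ m → + (l zero * 1 + m)) (ℕ.*-zeroʳ (f zero)) ⟩
  + (l zero * 1) ℤ.+ + 0
    ≡⟨ cong (ℤ._+ + 0) (ℤ.pos-* (l zero) 1) ⟩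
  + l zero ℤ.* + 1 ℤ.+ + 0 ∎
  where open ≡-Reasoning
∑∏≡∑ℤ {suc (suc r)} l f = cong₂ ℤ._+_ (ℤ.pos-* (l zero) _) (begin
  + (f zero * ∑∏ (l ∘ suc) (f ∘ suc))
    ≡⟨ ℤ.pos-* (f zero) _ ⟩
  + f zero ℤ.* + ∑∏ (l ∘ suc) (f ∘ suc)
    ≡⟨ cong (+ f zero ℤ.*_) (∑∏≡∑ℤ (l ∘ suc) (f ∘ suc)) ⟩
  + f zero ℤ.* ∑ℤ (λ i → + l (suc i) ℤ.* + ∏-except i (f ∘ suc))
    ≡⟨ Sumℤ.*-distribˡ-sum (+ f zero) (λ i → + l (suc i) ℤ.* + ∏-except i (f ∘ suc)) ⟩
  ∑ℤ (λ i → + f zero ℤ.* (+ l (suc i) ℤ.* + ∏-except i (f ∘ suc)))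
    ≡⟨ Sumℤ.sum-cong-≗ (λ i → exchange (f zero) (l (suc i)) (∏-except i (f ∘ suc))) ⟩
  ∑ℤ (λ i → + l (suc i) ℤ.* + ∏-except (suc i) f) ∎)
  where
  open ≡-Reasoning
  exchange : ∀ a b c → + a ℤ.* (+ b ℤ.* + c) ≡ + b ℤ.* + (a * c)
  exchange a b c = trans (ℤ-solve 3 (λ a b c → a :ℤ* (b :ℤ* c) :ℤ= b :ℤ* (a :ℤ* c)) refl (+ a) (+ b) (+ c))
                         (cong (+ b ℤ.*_) (sym (ℤ.pos-* a c)))

∏-split : ∀ i (f : Fin r → ℕ) → ∏ f ≡ f i * ∏-except i f
∏-split {suc _} i f = Prod.sum-remove {i = i} f

toℚᵘ-/ : ∀ m n .{{_ : NonZero n}} → toℚᵘ (m / n) ℚᵘ.≃ m ℚᵘ./ n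
toℚᵘ-/ m (suc n) = ℚ.toℚᵘ-fromℚᵘ (mkℚᵘ m n)

-- Carried out in the unnormalised rationals, where equality is cross-multiplication, since `_/_`
-- normalises.
/1-+ : ∀ m n → (m ℤ.+ n) / 1 ≡ m / 1 ℚ.+ n / 1
/1-+ m n = ℚ.toℚᵘ-injective (begin
  toℚᵘ ((m ℤ.+ n) / 1)            ≈⟨ toℚᵘ-/ (m ℤ.+ n) 1 ⟩
  mkℚᵘ (m ℤ.+ n) 0                ≈⟨ *≡* (ℤ-solve 2 (λ m n → (m :ℤ+ n) :ℤ* ℤ-con (+ 1) :ℤ= (m :ℤ* ℤ-con (+ 1) :ℤ+ n :ℤ* ℤ-con (+ 1)) :ℤ* ℤ-con (+ 1)) refl m n) ⟩
  mkℚᵘ m 0 ℚᵘ.+ mkℚᵘ n 0          ≈⟨ ℚᵘ.+-cong (ℚᵘ.≃-sym (toℚᵘ-/ m 1)) (ℚᵘ.≃-sym (toℚᵘ-/ n 1)) ⟩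
  toℚᵘ (m / 1) ℚᵘ.+ toℚᵘ (n / 1)  ≈⟨ ℚᵘ.≃-sym (ℚ.toℚᵘ-homo-+ (m / 1) (n / 1)) ⟩
  toℚᵘ (m / 1 ℚ.+ n / 1)          ∎)
  where
  open ℚᵘ.≃-Reasoning

-- The factor `f` of `k` cancels the denominator; with `k` the full product, `m` is the product over
-- the other gaps.
/1-*-/ : ∀ k l m f .{{_ : NonZero f}} → k ≡ + f ℤ.* m → (k / 1) ℚ.* (l / f) ≡ (l ℤ.* m) / 1
/1-*-/ k l m f@(suc f-1) refl = ℚ.toℚᵘ-injective (begin
  toℚᵘ ((k / 1) ℚ.* (l / f))        ≈⟨ ℚ.toℚᵘ-homo-* (k / 1) (l / f) ⟩
  toℚᵘ (k / 1) ℚᵘ.* toℚᵘ (l / f)    ≈⟨ ℚᵘ.*-cong (toℚᵘ-/ k 1) (toℚᵘ-/ l f) ⟩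
  mkℚᵘ k 0 ℚᵘ.* mkℚᵘ l f-1          ≈⟨ *≡* (trans (ℤ-solve 3 (λ f l m → (f :ℤ* m :ℤ* l) :ℤ* ℤ-con (+ 1) :ℤ= l :ℤ* m :ℤ* f) refl (+ f) l m)
                                        (cong (λ d → l ℤ.* m ℤ.* + d) (sym (ℕ.+-identityʳ f)))) ⟩
  mkℚᵘ (l ℤ.* m) 0                  ≈⟨ ℚᵘ.≃-sym (toℚᵘ-/ (l ℤ.* m) 1) ⟩
  toℚᵘ ((l ℤ.* m) / 1)              ∎)
  where
  open ℚᵘ.≃-Reasoning

∑-/1 : (f : Fin r → ℤ) → ∑ℤ f / 1 ≡ ∑ℚ (λ i → f i / 1)
∑-/1 {zero}  f = refl
∑-/1 {suc r} f = trans (/1-+ (f zero) (∑ℤ (f ∘ suc))) (cong (f zero / 1 ℚ.+_) (∑-/1 (f ∘ suc)))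

∑-quotients : (l : Fin r → ℤ) (f : Fin r → ℕ) (nz : ∀ i → NonZero (f i)) →
  (∑ℤ (λ i → l i ℤ.* + ∏-except i f)) / 1 ≡ ((+ ∏ f) / 1) ℚ.* ∑ℚ (λ i → (l i / f i) {{nz i}})
∑-quotients l f nz = begin
  (∑ℤ (λ i → l i ℤ.* + ∏-except i f)) / 1
    ≡⟨ ∑-/1 (λ i → l i ℤ.* + ∏-except i f) ⟩
  ∑ℚ (λ i → (l i ℤ.* + ∏-except i f) / 1)
    ≡⟨ Sumℚ.sum-cong-≗ (λ i → sym (/1-*-/ (+ ∏ f) (l i) (+ ∏-except i f) (f i) {{nz i}}
         (trans (cong +_ (∏-split i f)) (ℤ.pos-* (f i) _)))) ⟩
  ∑ℚ (λ i → ((+ ∏ f) / 1) ℚ.* (l i / f i) {{nz i}})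
    ≡⟨ sym (Sumℚ.*-distribˡ-sum ((+ ∏ f) / 1) (λ i → (l i / f i) {{nz i}})) ⟩
  ((+ ∏ f) / 1) ℚ.* ∑ℚ (λ i → (l i / f i) {{nz i}}) ∎
  where open ≡-Reasoning

∏-except-cong : ∀ {f g : Fin r → ℕ} → (∀ i → f i ≡ g i) → ∀ i → ∏-except i f ≡ ∏-except i g
∏-except-cong {suc r} eq i = Prod.sum-cong-≗ (λ j → eq (Fin.punchIn i j))

forests-∑ℤ : ∀ {N} (3≤N : 3 ≤ N) (a : Fin (suc r) → Fin N) → a Preserves Fin._<_ ⟶ Fin._<_ →
  + 𝓕 (wheel N 3≤N) (rimVertices a) ≡
  ∑ℤ (λ i → (+ lucas (2 * gap a i) ℤ.- + 2) ℤ.* + ∏-except i (λ i → fib (2 * gap a i)))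
forests-∑ℤ {N = N} 3≤N a a↑ = begin
  + 𝓕 (wheel N 3≤N) (rimVertices a)
    ≡⟨ cong (λ R → + 𝓕 (wheel N 3≤N) R) (rimVertices≡ a) ⟩
  + 𝓕 (wheel N 3≤N) (false ∷ rimSet a)
    ≡⟨ cong +_ (𝓕-trace 3≤N (rimSet a)) ⟩
  + proj₂ (trace (toList (rimSet a)))
    ≡⟨ cong (λ t → + proj₂ t) (trace-rimSet a a↑) ⟩
  + proj₂ (trace (word (gap a)))
    ≡⟨ cong +_ (trace-word (gap a) (gap-positive a↑)) ⟩
  + ∑∏ (luc₂ ∘ gap a) (fib₂ ∘ gap a)
    ≡⟨ ∑∏≡∑ℤ (luc₂ ∘ gap a) (fib₂ ∘ gap a) ⟩
  ∑ℤ (λ i → + luc₂ (gap a i) ℤ.* + ∏-except i (fib₂ ∘ gap a))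
    ≡⟨ Sumℤ.sum-cong-≗ (λ i → cong₂ (λ l p → l ℤ.* + p) (luc (gap a i))
         (∏-except-cong (λ j → sym (proj₁ (fib-double (gap a j)))) i)) ⟩
  ∑ℤ (λ i → (+ lucas (2 * gap a i) ℤ.- + 2) ℤ.* + ∏-except i (λ i → fib (2 * gap a i))) ∎
  where
  open ≡-Reasoning
  luc : ∀ d → + luc₂ d ≡ + lucas (2 * d) ℤ.- + 2
  -- By computation, 2 + `luc₂ d` minus 2 in the integers reduces to `luc₂ d`.
  luc d = sym (cong (λ l → + l ℤ.- + 2) (proj₁ (lucas-double d)))

theorem1p1 : (N : ℕ) (3≤N : 3 ≤ N) (r : ℕ) → 1 ≤ r → r ≤ N →
    (a : Fin r → Fin N) (a↑ : a Preserves Fin._<_ ⟶ Fin._<_) →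
    let forests = 𝓕 (wheel N 3≤N) (rimVertices a)
        F = λ i → fib (2 * gap a i)
        L-2 = λ i → + lucas (2 * gap a i) ℤ.- + 2
    in
    ((+ forests) / 1 ≡ ((+ ∏ F) / 1) ℚ.* ∑ℚ (λ i → (L-2 i / F i) {{fib-gap-nonZero a↑ i}}))
    ×
    (+ forests ≡ ∑ℤ (λ i → L-2 i ℤ.* + ∏-except i F))
theorem1p1 N 3≤N (suc r) _ _ a a↑ =
  trans (cong (_/ 1) eq) (∑-quotients (λ i → + lucas (2 * gap a i) ℤ.- + 2) (λ i → fib (2 * gap a i)) (fib-gap-nonZero a↑)) , eq
  where eq = forests-∑ℤ 3≤N a a↑
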